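{- There exists a constant $c$ such that for every positive integer $k$, every Hamiltonian graph $G$ on $n \ge c k^{7/3}$ vertices with $\alpha(G) \le k$ contains a cycle of length $n-1$.
   Context: Graphs are finite and simple. $\alpha(G)$ denotes the independence number of $G$, i.e. the order of a maximum independent set. A graph is Hamiltonian if it contains a cycle passing through every vertex exactly once. -}

module Defs where

open import Data.Bool.Base using (true; false)
open import Data.Fin.Base using (Fin)
open import Data.Fin.Properties using (all?)
open import Data.Fin.Subset using (Subset; _∈_; ∣_∣; ⊥)
open import Data.Fin.Subset.Properties using (_∈?_; ∉⊥)
open import Data.List.Base
  using (List; []; _∷_; [_]; _∷ʳ_; length; filter; cartesianProductWith)
open import Data.List.Extrema.Nat using (argmax; argmax-all; f[xs]≤f[argmax])
import Data.List.Membership.Propositional as List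
open import Data.List.Membership.Propositional.Properties
  using (∈-filter⁺; ∈-cartesianProductWith⁺)
import Data.List.Relation.Unary.All as All
open import Data.List.Relation.Unary.All.Properties using (all-filter)
open import Data.List.Relation.Unary.Any using (here; there)
open import Data.List.Relation.Unary.Linked using (Linked)
open import Data.List.Relation.Unary.Unique.Propositional using (Unique)
open import Data.Nat.Base using (ℕ; zero; suc; _≤_; _*_; _^_)
open import Data.Product.Base using (Σ-syntax)
open import Data.Vec.Base using ([]; _∷_)
open import Relation.Binary.Core using (Rel)
open import Relation.Binary.Definitions using (Decidable; Symmetric)
open import Relation.Binary.PropositionalEquality.Core using (_≡_; refl)
open import Relation.Nullary.Decidable using (Dec; ¬?; _→-dec_)
open import Relation.Nullary.Negation using (¬_)
open import Relation.Unary using (Pred)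
open import Level using (0ℓ)

-- Adjacency is decidable, as it is classically for any finite graph; this is
-- what makes the independence number computable.
record Graph (n : ℕ) : Set₁ where
  infix 4 _~_ _~?_
  field
    _~_      : Rel (Fin n) 0ℓ
    _~?_     : Decidable _~_
    ~-sym    : Symmetric _~_
    ~-irrefl : ∀ {v} → ¬ (v ~ v)

module _ {n : ℕ} (G : Graph n) where
  open Graph G

  Independent : Pred (Subset n) 0ℓ
  Independent S = ∀ u → u ∈ S → ∀ v → v ∈ S → ¬ (u ~ v)

  independent? : ∀ S → Dec (Independent S)
  independent? S = all? λ u → (u ∈? S) →-dec
                   (all? λ v → (v ∈? S) →-dec ¬? (u ~? v))

  -- `closed` says that x₁ ~ x₂ ~ … ~ x_m ~ x₁, where the pairwise distinct
  -- vertices are x₁ = start and x₂ … x_m = rest.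
  record Cycle : Set where
    field
      start    : Fin n
      rest     : List (Fin n)
    vertices : List (Fin n)
    vertices = start ∷ rest
    field
      distinct : Unique vertices
      long     : 3 ≤ length vertices
      closed   : Linked _~_ (vertices ∷ʳ start)

  ContainsCycleOfLength : ℕ → Set
  ContainsCycleOfLength m = Σ[ C ∈ Cycle ] length (Cycle.vertices C) ≡ m

  -- "Exactly once" is `Cycle.distinct`.
  Hamiltonian : Set
  Hamiltonian = Σ[ C ∈ Cycle ] (∀ v → v List.∈ Cycle.vertices C)

allSubsets : ∀ n → List (Subset n)
allSubsets zero    = [ [] ]
allSubsets (suc n) = cartesianProductWith _∷_ (true ∷ false ∷ []) (allSubsets n)

∈-allSubsets : ∀ {n} (S : Subset n) → S List.∈ allSubsets n
∈-allSubsets []      = here refl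
∈-allSubsets (b ∷ S) = ∈-cartesianProductWith⁺ _∷_ (∈-bools b) (∈-allSubsets S)
  where
  ∈-bools : ∀ b → b List.∈ (true ∷ false ∷ [])
  ∈-bools true  = here refl
  ∈-bools false = there (here refl)

module _ {n : ℕ} (G : Graph n) where

  independentSets : List (Subset n)
  independentSets = filter (independent? G) (allSubsets n)

  -- The empty set, which is independent, is the starting value of the search.
  maximumIndependentSet : Subset n
  maximumIndependentSet = argmax ∣_∣ ⊥ independentSets

  α : ℕ
  α = ∣ maximumIndependentSet ∣

  maximumIndependentSet-independent : Independent G maximumIndependentSet
  maximumIndependentSet-independent =
    argmax-all ∣_∣ {P = Independent G} (λ _ u∈⊥ → λ _ _ _ → ∉⊥ u∈⊥)
      (all-filter (independent? G) (allSubsets n))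

  independent⇒∣S∣≤α : ∀ {S} → Independent G S → ∣ S ∣ ≤ α
  independent⇒∣S∣≤α {S} ind =
    All.lookup (f[xs]≤f[argmax] {f = ∣_∣} ⊥ independentSets)
      (∈-filter⁺ (independent? G) (∈-allSubsets S) ind)

-- n ≥ c k^(7/3), cubed so as to stay in ℕ; cubing is strictly increasing, so
-- this is equivalent.  A natural constant c loses no generality over a real
-- one: the inequality only gets stronger when c is rounded up.
infix 4 _≥_·_^7/3
_≥_·_^7/3 : ℕ → ℕ → ℕ → Set
n ≥ c · k ^7/3 = c ^ 3 * k ^ 7 ≤ n ^ 3

{-# OPTIONS --safe #-}
module Submission where

-- Number the vertices along the Hamilton cycle.  If some shorter cycle misses
-- only vertices of degree larger than k + 1 plus the number of missing vertices,
-- then the Chvátal–Erdős argument (two neighbours of a missing vertex have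
-- adjacent successors) absorbs all of them but one.  So it suffices to drop
-- between 1 and 16 s ≤ 16 k vertices of degree at least 17 k + 3.
--
-- At most k (17 k + 3) vertices have smaller degree.  Hence, with s about
-- k^(1/3), among 24 k² blocks of 4 s consecutive vertices more than 3 k² contain
-- no such vertex.  In the left and in the right half of every block pick s
-- vertices, no two of them consecutive.  A chord inside a half is a shortcut;
-- if there is none, the graphs L and R on the blocks, which record the edges
-- between left halves and between right halves, have independence number at
-- most a = ⌊k / s⌋, where a³ ≤ k².  As there are more than a³ + a² + a blocks,
-- counting the triangles with two edges in the denser graph and one in the other
-- gives an edge wy of the latter with more than a common neighbours in the
-- former, among which there is again an edge vv′ of the latter.  Of the two
-- perfect matchings between {w, y} and {v, v′}, choose one so that exactly one
-- of it and {wy, vv′} is crossing.  Replacing the walks through the four blocks by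
-- these two L-chords and two R-chords then reconnects the four arcs to a single cycle.

open import Defs
open import Data.Fin.Base using (Fin; toℕ)
open import Data.Fin.Properties using (toℕ-injective; toℕ<n)
open import Data.Fin.Subset using (Subset; ∣_∣; ⁅_⁆; _∪_) renaming (_∈_ to _∈ˢ_; ⊥ to ∅)
open import Data.Fin.Subset.Properties
  using (x∈p∪q⁻; x∈p∪q⁺; x∈⁅x⁆; x∈⁅y⁆⇒x≡y; ∉⊥; p⊂q⇒∣p∣<∣q∣; q⊆p∪q)
open import Data.List.Base
  using (List; []; _∷_; [_]; _∷ʳ_; _++_; length; filter; map; foldr; reverse; drop; upTo; allFin;
         cartesianProductWith)
open import Data.List.Membership.DecPropositional using (_∈?_)
open import Data.List.Membership.Propositional using (_∈_; _∉_; find; lose)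
open import Data.List.Membership.Propositional.Properties
  using (∈-filter⁺; ∈-filter⁻; ∈-∃++; ∈-upTo⁺; ∈-upTo⁻; ∈-map⁻; ∈-++⁺ˡ; ∈-++⁺ʳ; ∈-allFin;
         ∈-cartesianProductWith⁻)
open import Data.List.Properties
  using (length-++; length-map; length-upTo; length-tabulate; length-filter; map-cong;
         unfold-reverse; filter-++; filter-some; filter-reject)
open import Data.List.Relation.Binary.Permutation.Propositional
  using (_↭_; ↭-refl; ↭-sym; ↭-trans; ↭-reflexive; prep; ↭⇒↭ₛ)
open import Data.List.Relation.Binary.Permutation.Propositional.Properties
  using (All-resp-↭; ∈-resp-↭; filter-↭; shift; shifts; ↭-length; ↭-reverse; ++⁺; ++⁺ˡ; ++⁺ʳ)
import Data.List.Relation.Binary.Permutation.Setoid.Properties as PermS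
open import Data.List.Relation.Binary.Subset.Propositional using (_⊆_)
open import Data.List.Relation.Unary.All using (All; []; _∷_)
import Data.List.Relation.Unary.All as All
import Data.List.Relation.Unary.All.Properties as All
open import Data.List.Relation.Unary.AllPairs using ([]; _∷_)
open import Data.List.Relation.Unary.Any using (Any; here; there; any?)
open import Data.List.Relation.Unary.Linked using (Linked; [-]; _∷_)
open import Data.List.Relation.Unary.Unique.Propositional using (Unique)
import Data.List.Relation.Unary.Unique.Propositional.Properties as Unique
open import Data.Nat.Base
open import Data.Nat.DivMod using (_/_; m/n*n≤m; m*n/n≡m; /-monoˡ-≤; m≥n⇒m/n>0)
open import Data.Nat.ListAction using (sum)
open import Data.Nat.Properties
open import Data.Nat.Tactic.RingSolver using (solve-∀)
open import Data.Product.Base using (Σ-syntax; ∃; ∃-syntax; _×_; _,_; proj₁; proj₂)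
open import Data.Sum.Base using (_⊎_; inj₁; inj₂)
open import Function.Base using (_∘_; id)
open import Level using (0ℓ)
open import Relation.Binary.Core using (Rel)
open import Relation.Binary.Definitions using (Decidable; Symmetric; Tri; tri<; tri≈; tri>)
open import Relation.Binary.PropositionalEquality
  using (_≡_; _≢_; refl; sym; trans; cong; cong₂; subst; setoid; module ≡-Reasoning)
open import Relation.Nullary.Decidable using (Dec; yes; no; _×-dec_; ¬?; decidable-stable; map′)
open import Relation.Nullary.Negation using (¬_; contradiction)
open import Relation.Unary using (Pred)

private variable A B : Set

-- Counting edges under a bound on the independence number

unique-resp-↭ : {xs ys : List A} → xs ↭ ys → Unique xs → Unique ys
unique-resp-↭ p = PermS.Unique-resp-↭ (setoid _) (↭⇒↭ₛ p)

∑ : (A → ℕ) → List A → ℕ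
∑ f xs = sum (map f xs)

∑-mono : {f g : A → ℕ} (xs : List A) → (∀ x → f x ≤ g x) → ∑ f xs ≤ ∑ g xs
∑-mono []       f≤g = z≤n
∑-mono (x ∷ xs) f≤g = +-mono-≤ (f≤g x) (∑-mono xs f≤g)

∑-+ : (f g : A → ℕ) (xs : List A) → ∑ (λ x → f x + g x) xs ≡ ∑ f xs + ∑ g xs
∑-+ f g []       = refl
∑-+ f g (x ∷ xs) = trans (cong (f x + g x +_) (∑-+ f g xs)) (interchange (f x) (g x) _ _)
  where
  interchange : ∀ a b c d → a + b + (c + d) ≡ a + c + (b + d)
  interchange = solve-∀

∑-*ˡ : (a : ℕ) (f : A → ℕ) (xs : List A) → ∑ (λ x → a * f x) xs ≡ a * ∑ f xs
∑-*ˡ a f []       = sym (*-zeroʳ a)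
∑-*ˡ a f (x ∷ xs) = trans (cong (a * f x +_) (∑-*ˡ a f xs)) (sym (*-distribˡ-+ a (f x) _))

∑-const : (c : ℕ) (xs : List A) → ∑ (λ _ → c) xs ≡ length xs * c
∑-const c []       = refl
∑-const c (x ∷ xs) = cong (c +_) (∑-const c xs)

indicator : {P : Set} → Dec P → ℕ
indicator (yes _) = 1
indicator (no _)  = 0

length-filter≡∑ : {P : Pred A 0ℓ} (P? : ∀ x → Dec (P x)) (xs : List A) →
  length (filter P? xs) ≡ ∑ (λ x → indicator (P? x)) xs
length-filter≡∑ P? []       = refl
length-filter≡∑ P? (x ∷ xs) with P? x
... | yes _ = cong suc (length-filter≡∑ P? xs)
... | no _  = length-filter≡∑ P? xs

IsIndependent : Rel A 0ℓ → List A → Set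
IsIndependent R I = ∀ {x y} → x ∈ I → y ∈ I → ¬ R x y

module EdgeCount {A : Set} {R : Rel A 0ℓ} (R? : Decidable R) where

  degreeIn : List A → A → ℕ
  degreeIn S x = length (filter (R? x) S)

  edges : List A → ℕ
  edges []      = 0
  edges (x ∷ S) = degreeIn S x + edges S

  module _ (R-sym : Symmetric R) (R-irrefl : ∀ {x} → ¬ R x x) where

    -- Handshake lemma. `edges` counts each edge at its earlier endpoint, so a new head `x` adds its
    -- degree twice: once as its own, once spread over its neighbours (`split`).
    ∑-degree : ∀ S → ∑ (degreeIn S) S ≡ 2 * edges S
    ∑-degree [] = refl
    ∑-degree (x ∷ S) = begin
      degreeIn (x ∷ S) x + ∑ (degreeIn (x ∷ S)) S
        ≡⟨ cong₂ _+_ (cong length (filter-reject (R? x) R-irrefl)) (split S) ⟩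
      degreeIn S x + (degreeIn S x + ∑ (degreeIn S) S)
        ≡⟨ cong (λ e → degreeIn S x + (degreeIn S x + e)) (∑-degree S) ⟩
      degreeIn S x + (degreeIn S x + 2 * edges S)
        ≡⟨ rearrange (degreeIn S x) (edges S) ⟩
      2 * (degreeIn S x + edges S) ∎
      where
      open ≡-Reasoning
      rearrange : ∀ d e → d + (d + 2 * e) ≡ 2 * (d + e)
      rearrange = solve-∀
      step-cons : ∀ v → degreeIn (x ∷ S) v ≡ indicator (R? x v) + degreeIn S v
      step-cons v with R? v x | R? x v
      ... | yes _   | yes _   = refl
      ... | no _    | no _    = refl
      ... | yes vx  | no ¬xv  = contradiction (R-sym vx) ¬xv
      ... | no ¬vx  | yes xv  = contradiction (R-sym xv) ¬vx
      split : ∀ T → ∑ (degreeIn (x ∷ S)) T ≡ degreeIn T x + ∑ (degreeIn S) T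
      split T = begin
        ∑ (degreeIn (x ∷ S)) T                               ≡⟨ cong sum (map-cong step-cons T) ⟩
        ∑ (λ v → indicator (R? x v) + degreeIn S v) T        ≡⟨ ∑-+ _ (degreeIn S) T ⟩
        ∑ (λ v → indicator (R? x v)) T + ∑ (degreeIn S) T    ≡⟨ cong (_+ _) (length-filter≡∑ (R? x) T) ⟨
        degreeIn T x + ∑ (degreeIn S) T                      ∎

    -- A greedy independent set `I`, built from the end of the list: a vertex with a neighbour in
    -- `I` goes to `J`. One edge into `I` for each vertex of `J` gives `edges-drop`.
    record Domination (S : List A) : Set where
      field
        I J         : List A
        partition   : S ↭ I ++ J
        independent : IsIndependent R I
        dominated   : All (λ x → Any (R x) I) J
        edges-drop  : length J + edges J ≤ edges S

    dominate : ∀ S → Domination S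
    dominate [] = record
      { I = [] ; J = [] ; partition = ↭-refl ; independent = λ ()
      ; dominated = [] ; edges-drop = z≤n }
    dominate (x ∷ S) with dominate S
    ... | D with any? (R? x) (Domination.I D)
    ... | yes x~I = record
      { I = I ; J = x ∷ J
      ; partition = ↭-trans (prep x partition) (↭-sym (shift x I J))
      ; independent = independent
      ; dominated = x~I ∷ dominated
      ; edges-drop = begin
          suc (length J) + (degreeIn J x + edges J)
            ≡⟨ rearrange (length J) (degreeIn J x) (edges J) ⟩
          (1 + degreeIn J x) + (length J + edges J)
            ≤⟨ +-mono-≤ (+-monoˡ-≤ (degreeIn J x) (degree-positive x~I)) edges-drop ⟩
          (degreeIn I x + degreeIn J x) + edges S
            ≡⟨ cong (_+ edges S) (degree-split) ⟨
          degreeIn S x + edges S ∎ }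
      where
      open Domination D
      open ≤-Reasoning
      degree-positive : ∀ {x I} → Any (R x) I → 1 ≤ degreeIn I x
      degree-positive {x} = filter-some (R? x)
      rearrange : ∀ a b c → suc a + (b + c) ≡ (1 + b) + (a + c)
      rearrange = solve-∀
      degree-split : degreeIn S x ≡ degreeIn I x + degreeIn J x
      degree-split = trans (↭-length (filter-↭ (R? x) partition))
        (trans (cong length (filter-++ (R? x) I J)) (length-++ (filter (R? x) I)))
    ... | no x≁I = record
      { I = x ∷ I ; J = J
      ; partition = prep x partition
      ; independent = extended
      ; dominated = All.map there dominated
      ; edges-drop = ≤-trans edges-drop (m≤n+m (edges S) _) }
      where
      open Domination D
      extended : IsIndependent R (x ∷ I)
      extended (here refl) (here refl) = R-irrefl
      extended (here refl) (there y∈I) = λ xy → x≁I (lose y∈I xy)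
      extended (there y∈I) (here refl) = λ yx → x≁I (lose y∈I (R-sym yx))
      extended (there y∈I) (there z∈I) = independent y∈I z∈I

triangle : ℕ → ℕ
triangle zero    = 0
triangle (suc t) = suc t + triangle t

2*triangle : ∀ t → 2 * triangle t ≡ t * suc t
2*triangle zero    = refl
2*triangle (suc t) = trans (*-distribˡ-+ 2 (suc t) (triangle t))
  (trans (cong (2 * suc t +_) (2*triangle t)) (expand t))
  where
  expand : ∀ t → 2 * suc t + t * suc t ≡ suc t * suc (suc t)
  expand = solve-∀

IndependenceBound : {A : Set} → Rel A 0ℓ → Pred A 0ℓ → ℕ → Set
IndependenceBound R Ok a =
  ∀ I → Unique I → All Ok I → IsIndependent R I → length I ≤ a

unique-++⁻ : {A : Set} (xs : List A) {ys : List A} → Unique (xs ++ ys) → Unique xs × Unique ys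
unique-++⁻ []       u       = [] , u
unique-++⁻ (x ∷ xs) (a ∷ u) =
  (All.++⁻ˡ xs a ∷ proj₁ (unique-++⁻ xs u)) , proj₂ (unique-++⁻ xs u)

module Turán {A : Set} {R : Rel A 0ℓ} (R? : Decidable R) (R-sym : Symmetric R)
             (R-irrefl : ∀ {x} → ¬ R x x) {Ok : Pred A 0ℓ} {a : ℕ}
             (bound : IndependenceBound R Ok a) where
  open EdgeCount R?

  -- A family of bounds linear in length S, rather than Turán's quadratic one, because
  -- linear bounds can be summed over all neighbourhoods; t is chosen only afterwards.
  edges-bound : ∀ t S → Unique S → All Ok S → t * length S ≤ edges S + a * triangle t
  edges-bound zero    S S! okS = z≤n
  edges-bound (suc t) S S! okS = begin
    length S + t * length S
      ≡⟨ cong (λ l → l + t * l) (trans (↭-length partition) (length-++ I)) ⟩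
    (length I + length J) + t * (length I + length J)
      ≡⟨ rearrange₁ (length I) (length J) t ⟩
    -- Each of the at most `a` vertices of `I` is charged `suc t`; the extra `length J` is paid by
    -- the edges that disappear with `I`.
    suc t * length I + (length J + t * length J)
      ≤⟨ +-mono-≤ (*-monoʳ-≤ (suc t) |I|≤a)
           (+-monoʳ-≤ (length J) (edges-bound t J (proj₂ parts!) (All.++⁻ʳ I okIJ))) ⟩
    suc t * a + (length J + (edges J + a * triangle t))
      ≡⟨ rearrange₂ t a (length J) (edges J) (triangle t) ⟩
    (length J + edges J) + a * triangle (suc t)
      ≤⟨ +-monoˡ-≤ _ edges-drop ⟩
    edges S + a * triangle (suc t) ∎
    where
    open ≤-Reasoning
    open Domination (dominate R-sym R-irrefl S)
    okIJ : All Ok (I ++ J)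
    okIJ = All-resp-↭ partition okS
    parts! : Unique I × Unique J
    parts! = unique-++⁻ I (unique-resp-↭ partition S!)
    |I|≤a : length I ≤ a
    |I|≤a = bound I (proj₁ parts!) (All.++⁻ˡ I okIJ) independent
    rearrange₁ : ∀ i j t → (i + j) + t * (i + j) ≡ suc t * i + (j + t * j)
    rearrange₁ = solve-∀
    rearrange₂ : ∀ t a j e Δ → suc t * a + (j + (e + a * Δ)) ≡ (j + e) + a * (suc t + Δ)
    rearrange₂ = solve-∀

module Codegree {A : Set} {R₁ R₂ : Rel A 0ℓ} (R₁? : Decidable R₁) (R₂? : Decidable R₂)
                (B : List A) (a : ℕ) where
  open EdgeCount R₂? using (edges)

  common : A → A → List A
  common x y = filter (λ v → R₁? v x ×-dec R₁? v y) B

  private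
    -- Counts the triangles with apex `v` and base from `x` into `S`: the base lies in `R₂`, the two
    -- sides in `R₁`.
    star : A → List A → A → ℕ
    star x S v with R₁? v x
    ... | yes _ = length (filter (R₂? x) (filter (R₁? v) S))
    ... | no _  = 0

    cherry : A → A → A → ℕ
    cherry x y v = indicator (R₁? v x ×-dec R₁? v y)

    star-accept : ∀ x y S v → R₂ x y → star x (y ∷ S) v ≤ cherry x y v + star x S v
    star-accept x y S v xy with R₁? v x
    ... | no _ = z≤n
    ... | yes _ with R₁? v y
    ...   | no _  = ≤-refl
    ...   | yes _ with R₂? x y
    ...     | yes _  = ≤-refl
    ...     | no ¬xy = contradiction xy ¬xy

    star-reject : ∀ x y S v → ¬ R₂ x y → star x (y ∷ S) v ≤ star x S v
    star-reject x y S v ¬xy with R₁? v x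
    ... | no _ = z≤n
    ... | yes _ with R₁? v y
    ...   | no _  = ≤-refl
    ...   | yes _ with R₂? x y
    ...     | yes xy = contradiction xy ¬xy
    ...     | no _   = ≤-refl

    edges-cons : ∀ x S v → edges (filter (R₁? v) (x ∷ S)) ≤ star x S v + edges (filter (R₁? v) S)
    edges-cons x S v with R₁? v x
    ... | yes _ = ≤-refl
    ... | no _  = ≤-refl

    ∑-star : ∀ x S → (∀ {y} → y ∈ S → R₂ x y → length (common x y) ≤ a) →
      ∑ (star x S) B ≤ a * length (filter (R₂? x) S)
    ∑-star x [] _ = ≤-reflexive (trans (go B) (sym (*-zeroʳ a)))
      where
      star-[] : ∀ v → star x [] v ≡ 0
      star-[] v with R₁? v x
      ... | yes _ = refl
      ... | no _  = refl
      go : ∀ B → ∑ (star x []) B ≡ 0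
      go []      = refl
      go (v ∷ B) = cong₂ _+_ (star-[] v) (go B)
    ∑-star x (y ∷ S) few with R₂? x y
    ... | no ¬xy = ≤-trans (∑-mono B (λ v → star-reject x y S v ¬xy)) (∑-star x S (few ∘ there))
    ... | yes xy = begin
      ∑ (star x (y ∷ S)) B                        ≤⟨ ∑-mono B (λ v → star-accept x y S v xy) ⟩
      ∑ (λ v → cherry x y v + star x S v) B       ≡⟨ ∑-+ (cherry x y) (star x S) B ⟩
      ∑ (cherry x y) B + ∑ (star x S) B
        ≤⟨ +-mono-≤ (≤-trans (≤-reflexive (sym (length-filter≡∑ _ B))) (few (here refl) xy))
                    (∑-star x S (few ∘ there)) ⟩
      a + a * length (filter (R₂? x) S)           ≡⟨ *-suc a _ ⟨
      a * suc (length (filter (R₂? x) S))         ∎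
      where open ≤-Reasoning

  -- Double counting of the triangles with base in `R₂` and two sides in `R₁`. Sorted by apex they
  -- give the left side; sorted by base, each `R₂`-edge in `S` has at most `a` possible apexes.
  ∑-edges : ∀ S → (∀ {x y} → x ∈ S → y ∈ S → R₂ x y → length (common x y) ≤ a) →
    ∑ (λ v → edges (filter (R₁? v) S)) B ≤ a * edges S
  ∑-edges [] _ = ≤-reflexive (trans (∑-const 0 B) (trans (*-zeroʳ (length B)) (sym (*-zeroʳ a))))
  ∑-edges (x ∷ S) few = begin
    ∑ (λ v → edges (filter (R₁? v) (x ∷ S))) B
      ≤⟨ ∑-mono B (edges-cons x S) ⟩
    ∑ (λ v → star x S v + edges (filter (R₁? v) S)) B
      ≡⟨ ∑-+ (star x S) _ B ⟩
    ∑ (star x S) B + ∑ (λ v → edges (filter (R₁? v) S)) B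
      ≤⟨ +-mono-≤ (∑-star x S (λ y∈S → few (here refl) (there y∈S)))
                  (∑-edges S (λ x∈S y∈S → few (there x∈S) (there y∈S))) ⟩
    a * length (filter (R₂? x) S) + a * edges S
      ≡⟨ *-distribˡ-+ a _ (edges S) ⟨
    a * edges (x ∷ S) ∎
    where open ≤-Reasoning

-- The four `R₁`-edges contain both perfect matchings between `w`, `y` and `v`, `v′`; the order of
-- the four blocks decides which one is used.
record Pattern {A : Set} (R₁ R₂ : Rel A 0ℓ) (B : List A) : Set where
  field
    {w y v v′} : A
    w∈ : w ∈ B
    y∈ : y ∈ B
    v∈ : v ∈ B
    v′∈ : v′ ∈ B
    wy : R₂ w y
    vv′ : R₂ v v′
    vw : R₁ v w
    vy : R₁ v y
    v′w : R₁ v′ w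
    v′y : R₁ v′ y

-- The independence bound has the form `suc a` because the argument divides by it and by
-- `triangle (suc a)`. With α₀ for `suc a`, `large` asks for more than α₀³ + α₀² + α₀ elements.
module FindPattern
  {A : Set} {Ok : Pred A 0ℓ} {B : List A} (B! : Unique B) (okB : All Ok B) {a : ℕ}
  (large : suc a * (suc a * suc (suc a) + 1) < length B)
  {R₁ R₂ : Rel A 0ℓ} (R₁? : Decidable R₁) (R₂? : Decidable R₂)
  (R₁-sym : Symmetric R₁) (R₂-sym : Symmetric R₂)
  (R₁-irrefl : ∀ {x} → ¬ R₁ x x) (R₂-irrefl : ∀ {x} → ¬ R₂ x x)
  (bound₁ : IndependenceBound R₁ Ok (suc a)) (bound₂ : IndependenceBound R₂ Ok (suc a))
  where
  private
    α₀ = suc a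
    module E₁ = EdgeCount R₁?
    module E₂ = EdgeCount R₂?
    module T₁ = Turán R₁? R₁-sym R₁-irrefl bound₁
    module T₂ = Turán R₂? R₂-sym R₂-irrefl bound₂
    open Codegree R₁? R₂? B α₀

  dependent-pair : ∀ S → Unique S → All Ok S → α₀ < length S →
    Σ[ x ∈ A ] Σ[ y ∈ A ] (x ∈ S × y ∈ S × R₂ x y)
  dependent-pair S S! okS α₀<S with any? (λ x → any? (R₂? x) S) S
  ... | yes some = let x , x∈S , some′ = find some ; y , y∈S , xy = find some′
                   in x , y , x∈S , y∈S , xy
  ... | no none  = contradiction
    (bound₂ S S! okS (λ x∈S y∈S xy → none (lose x∈S (lose y∈S xy)))) (<⇒≱ α₀<S)

  -- Turán's bound for `R₂` inside every `R₁`-neighbourhood forces mixed triangles. With few common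
  -- neighbours, and `R₂` no denser than `R₁`, this caps the number of `R₁`-edges at `N * Δ`;
  -- Turán's bound for `R₁` on all of `B` then caps `N`.
  few-edges : E₂.edges B ≤ E₁.edges B →
    (∀ {x y} → x ∈ B → y ∈ B → R₂ x y → length (common x y) ≤ α₀) →
    length B ≤ α₀ * (α₀ * suc α₀ + 1)
  few-edges e₂≤e₁ few = *-cancelʳ-≤ N _ Δ (+-cancelˡ-≤ (Δ * N) _ _ (begin
      Δ * N + N * Δ                      ≡⟨ double Δ N ⟩
      -- By `e₁≤` the average `R₁`-degree is at most `2 * Δ`, which suggests this value of `t`.
      2 * Δ * N                          ≤⟨ T₁.edges-bound (2 * Δ) B B! okB ⟩
      e₁ + α₀ * triangle (2 * Δ)         ≤⟨ +-monoˡ-≤ _ e₁≤ ⟩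
      N * Δ + α₀ * triangle (2 * Δ)      ≡⟨ cong₂ _+_ (*-comm N Δ) (cong (α₀ *_) tri2Δ) ⟩
      Δ * N + α₀ * (Δ * (2 * Δ + 1))     ≡⟨ cong (Δ * N +_) (assoc α₀ Δ (2 * Δ + 1)) ⟩
      Δ * N + α₀ * (2 * Δ + 1) * Δ       ≡⟨ cong (λ t → Δ * N + α₀ * (t + 1) * Δ) (2*triangle α₀) ⟩
      Δ * N + α₀ * (α₀ * suc α₀ + 1) * Δ ∎))
    where
    open ≤-Reasoning
    N = length B
    e₁ = E₁.edges B
    Δ = triangle α₀
    double : ∀ d n → d * n + n * d ≡ 2 * d * n
    double = solve-∀
    assoc : ∀ a d c → a * (d * c) ≡ a * c * d
    assoc = solve-∀
    tri2Δ : triangle (2 * Δ) ≡ Δ * (2 * Δ + 1)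
    tri2Δ = *-cancelˡ-≡ _ _ 2 (trans (2*triangle (2 * Δ)) (lemma Δ))
      where
      lemma : ∀ d → 2 * d * suc (2 * d) ≡ 2 * (d * (2 * d + 1))
      lemma = solve-∀
    triples : α₀ * (2 * e₁) ≤ α₀ * e₁ + α₀ * (N * Δ)
    triples = begin
      α₀ * (2 * e₁)
        ≡⟨ cong (α₀ *_) (E₁.∑-degree R₁-sym R₁-irrefl B) ⟨
      α₀ * ∑ (E₁.degreeIn B) B
        ≡⟨ ∑-*ˡ α₀ (E₁.degreeIn B) B ⟨
      ∑ (λ v → α₀ * E₁.degreeIn B v) B
        ≤⟨ ∑-mono B (λ v → T₂.edges-bound α₀ (filter (R₁? v) B) (Unique.filter⁺ (R₁? v) B!)
             (All.filter⁺ (R₁? v) okB)) ⟩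
      ∑ (λ v → E₂.edges (filter (R₁? v) B) + α₀ * Δ) B
        ≡⟨ ∑-+ _ _ B ⟩
      ∑ (λ v → E₂.edges (filter (R₁? v) B)) B + ∑ (λ _ → α₀ * Δ) B
        ≤⟨ +-mono-≤ (∑-edges B few) (≤-reflexive (∑-const (α₀ * Δ) B)) ⟩
      α₀ * E₂.edges B + N * (α₀ * Δ)
        ≤⟨ +-mono-≤ (*-monoʳ-≤ α₀ e₂≤e₁) (≤-reflexive (swap N α₀ Δ)) ⟩
      α₀ * e₁ + α₀ * (N * Δ) ∎
      where
      swap : ∀ n a d → n * (a * d) ≡ a * (n * d)
      swap = solve-∀
    e₁≤ : e₁ ≤ N * Δ
    e₁≤ = *-cancelˡ-≤ α₀ (+-cancelˡ-≤ (α₀ * e₁) _ _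
      (≤-trans (≤-reflexive (twice α₀ e₁)) triples))
      where
      twice : ∀ a e → a * e + a * e ≡ a * (2 * e)
      twice = solve-∀

  find-pattern : E₂.edges B ≤ E₁.edges B → Pattern R₁ R₂ B
  find-pattern e₂≤e₁
    with any? (λ x → any? (λ y → R₂? x y ×-dec (α₀ <? length (common x y))) B) B
  ... | no none = contradiction
    (few-edges e₂≤e₁ (λ x∈ y∈ xy → ≮⇒≥ (λ many → none (lose x∈ (lose y∈ (xy , many)))))) (<⇒≱ large)
  ... | yes some with find some
  ... | w , w∈ , some′ with find some′
  ... | y , y∈ , wy , many
    with dependent-pair (common w y)
           (Unique.filter⁺ (λ v → R₁? v w ×-dec R₁? v y) B!)
           (All.filter⁺ (λ v → R₁? v w ×-dec R₁? v y) okB)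
           many
  ... | v , v′ , v∈ , v′∈ , vv′
    with ∈-filter⁻ (λ v → R₁? v w ×-dec R₁? v y) {xs = B} v∈
       | ∈-filter⁻ (λ v → R₁? v w ×-dec R₁? v y) {xs = B} v′∈
  ... | v∈B , vw , vy | v′∈B , v′w , v′y = record
    { w∈ = w∈ ; y∈ = y∈ ; v∈ = v∈B ; v′∈ = v′∈B ; wy = wy ; vv′ = vv′
    ; vw = vw ; vy = vy ; v′w = v′w ; v′y = v′y }

-- Paths and the absorption of missing vertices

unique-⊆-length : {xs ys : List A} → Unique xs → xs ⊆ ys → length xs ≤ length ys
unique-⊆-length {xs = []} _ _ = z≤n
unique-⊆-length {xs = x ∷ xs} (x∉xs ∷ xs!) xs⊆ys with ∈-∃++ (xs⊆ys (here refl))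
... | ps , qs , refl = ≤-trans (s≤s (unique-⊆-length xs! xs⊆rest))
                               (≤-reflexive (sym (↭-length (shift x ps qs))))
  where
  xs⊆rest : xs ⊆ ps ++ qs
  xs⊆rest z∈xs with ∈-resp-↭ (shift x ps qs) (xs⊆ys (there z∈xs))
  ... | here refl = contradiction refl (All.lookup x∉xs z∈xs)
  ... | there z∈  = z∈

unique-map⁺ : {B : Set} {f : A → B} {xs : List A} →
  (∀ {x y} → x ∈ xs → y ∈ xs → f x ≡ f y → x ≡ y) → Unique xs → Unique (map f xs)
unique-map⁺ inj []         = []
unique-map⁺ inj (x∉ ∷ xs!) =
  All.map⁺ (All.tabulate (λ y∈ eq → All.lookup x∉ y∈ (inj (here refl) (there y∈) eq)))
  ∷ unique-map⁺ (λ x∈ y∈ → inj (there x∈) (there y∈)) xs!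

length-filter-complement : {A : Set} {P : Pred A 0ℓ} (P? : ∀ x → Dec (P x)) (xs : List A) →
  length xs ≡ length (filter P? xs) + length (filter (¬? ∘ P?) xs)
length-filter-complement P? [] = refl
length-filter-complement P? (y ∷ ys) with P? y
... | yes _ = cong suc (length-filter-complement P? ys)
... | no _  = trans (cong suc (length-filter-complement P? ys)) (sym (+-suc _ _))

tail⊆ : (xs : List A) → drop 1 xs ⊆ xs
tail⊆ (x ∷ xs) = there

data Path (E : Rel A 0ℓ) : A → A → List A → Set where
  stop : ∀ {x} → Path E x x [ x ]
  step : ∀ {x y z ys} → E x y → Path E y z ys → Path E x z (x ∷ ys)

module _ {E : Rel A 0ℓ} where

  join : ∀ {a b c d xs ys} → Path E a b xs → E b c → Path E c d ys → Path E a d (xs ++ ys)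
  join stop       bc q = step bc q
  join (step e p) bc q = step e (join p bc q)

  reversed : Symmetric E → ∀ {a b xs} → Path E a b xs → Path E b a (reverse xs)
  reversed E-sym stop = stop
  reversed E-sym (step {x} {ys = ys} e p) =
    subst (Path E _ x) (sym (unfold-reverse x ys)) (join (reversed E-sym p) (E-sym e) stop)

ClosedPath : Rel A 0ℓ → List A → Set
ClosedPath {A} E xs = Σ[ a ∈ A ] Σ[ b ∈ A ] (Path E a b xs × E b a)

module Rotation {A : Set} {E : Rel A 0ℓ} (E? : Decidable E) (E-sym : Symmetric E)
                (E-irrefl : ∀ {x} → ¬ E x x) {P : Pred A 0ℓ} (P? : ∀ x → Dec (P x)) where

  -- For `P` the adjacency to a missing vertex `x`, the pieces rejoin as `S₀`, `x`, reversed `S₁`,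
  -- `S₂`: a path with the same ends that contains `x`.
  record Detour (a z : A) (xs : List A) : Set where
    field
      {b b⁺ c c⁺} : A
      {S₀ S₁ S₂}  : List A
      first       : Path E a b S₀
      second      : Path E b⁺ c S₁
      third       : Path E c⁺ z S₂
      Pb          : P b
      Pc          : P c
      b⁺c⁺        : E b⁺ c⁺
      pieces      : xs ≡ S₀ ++ S₁ ++ S₂

  successors : ∀ {a z xs} → Path E a z xs → List A
  successors stop = []
  successors (step {x} {y} e p) with P? x
  ... | yes _ = y ∷ successors p
  ... | no _  = successors p

  -- The last vertex of the path has no successor on it, hence the `suc`.
  length-successors : ∀ {a z xs} (p : Path E a z xs) →
    length (filter P? xs) ≤ suc (length (successors p))
  length-successors {xs = xs} stop = length-filter P? xs
  length-successors (step {x} e p) with P? x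
  ... | yes _ = s≤s (length-successors p)
  ... | no _  = length-successors p

  successors⊆tail : ∀ {a z xs} (p : Path E a z xs) → successors p ⊆ drop 1 xs
  successors⊆tail stop ()
  successors⊆tail (step {x} {y} e p) t∈ with P? x
  successors⊆tail (step e stop)       (here refl) | yes _ = here refl
  successors⊆tail (step e (step f p)) (here refl) | yes _ = here refl
  successors⊆tail (step e p)          (there t∈)  | yes _ = tail⊆ _ (successors⊆tail p t∈)
  successors⊆tail (step e p)          t∈          | no _  = tail⊆ _ (successors⊆tail p t∈)

  successors-unique : ∀ {a z xs} (p : Path E a z xs) → Unique xs → Unique (successors p)
  successors-unique stop _ = []
  successors-unique (step {x} {y} e p) (_ ∷ ys!) with P? x
  ... | no _  = successors-unique p ys!
  ... | yes _ =
    All.tabulate (λ t∈ → start≢tail p ys! (successors⊆tail p t∈)) ∷ successors-unique p ys!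
    where
    start≢tail : ∀ {a z xs t} → Path E a z xs → Unique xs → t ∈ drop 1 xs → a ≢ t
    start≢tail stop       _          ()
    start≢tail (step e p) (a∉ ∷ _) t∈ = All.lookup a∉ t∈

  split-at-successor : ∀ {a z xs t} (p : Path E a z xs) → t ∈ successors p →
    Σ[ c ∈ A ] Σ[ S₁ ∈ List A ] Σ[ S₂ ∈ List A ]
      (Path E a c S₁ × Path E t z S₂ × P c × xs ≡ S₁ ++ S₂)
  split-at-successor (step {x} {y} e p) t∈ with P? x
  split-at-successor (step {x} e p) (here refl) | yes Px = x , [ x ] , _ , stop , p , Px , refl
  split-at-successor (step {x} e p) (there t∈)  | yes _ with split-at-successor p t∈
  ... | c , S₁ , S₂ , q , r , Pc , refl = c , x ∷ S₁ , S₂ , step e q , r , Pc , refl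
  split-at-successor (step {x} e p) t∈          | no _ with split-at-successor p t∈
  ... | c , S₁ , S₂ , q , r , Pc , refl = c , x ∷ S₁ , S₂ , step e q , r , Pc , refl

  -- Induction from the end of the path: only the newest successor `y` has to be compared with those
  -- further on, and a neighbour among them starts the third piece.
  detour-or-independent : ∀ {a z xs} (p : Path E a z xs) →
    Detour a z xs ⊎ IsIndependent E (successors p)
  detour-or-independent stop = inj₂ λ ()
  detour-or-independent (step {x} {y} e p) with detour-or-independent p
  ... | inj₁ d = inj₁ record
    { first = step e first ; second = second ; third = third
    ; Pb = Pb ; Pc = Pc ; b⁺c⁺ = b⁺c⁺ ; pieces = cong (x ∷_) pieces }
    where open Detour d
  ... | inj₂ ind with P? x
  ...   | no _ = inj₂ ind
  ...   | yes Px with any? (E? y) (successors p)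
  ...     | yes some = inj₁ (build (find some))
    where
    build : ∃ (λ t → t ∈ successors p × E y t) → Detour x _ _
    build (t , t∈ , yt) with split-at-successor p t∈
    ... | c , S₁ , S₂ , q , r , Pc , eq = record
      { first = stop ; second = q ; third = r
      ; Pb = Px ; Pc = Pc ; b⁺c⁺ = yt ; pieces = cong (x ∷_) eq }
  ...     | no none = inj₂ extended
    where
    extended : IsIndependent E (y ∷ successors p)
    extended (here refl) (here refl) = E-irrefl
    extended (here refl) (there t∈) = λ yt → none (lose t∈ yt)
    extended (there t∈) (here refl) = λ ty → none (lose t∈ (E-sym ty))
    extended (there s∈) (there t∈) = ind s∈ t∈

module Absorption (n k : ℕ) {E : Rel ℕ 0ℓ} (E? : Decidable E) (E-sym : Symmetric E)
                  (E-irrefl : ∀ {x} → ¬ E x x) (bound : IndependenceBound E (_< n) k) where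

  degree : ℕ → ℕ
  degree x = length (filter (E? x) (upTo n))

  record CycleOn (xs : List ℕ) : Set where
    field
      closed  : ClosedPath E xs
      unique  : Unique xs
      bounded : All (_< n) xs

  -- `xs` omits `n` minus its length numbers below `n`, so it misses at most that many satisfying
  -- `P`. The proof compares the numbers failing `P`, avoiding subtraction.
  length-filter-⊆ : {P : Pred ℕ 0ℓ} (P? : ∀ x → Dec (P x)) {xs : List ℕ} → Unique xs → All (_< n) xs →
    length (filter P? (upTo n)) + length xs ≤ length (filter P? xs) + n
  length-filter-⊆ P? {xs} xs! xs<n = +-cancelʳ-≤ c₁ _ _ (begin
    f₁ + l + c₁                           ≡⟨ cong (λ z → f₁ + z + c₁) (length-filter-complement P? xs) ⟩
    f₁ + (f₂ + c₂) + c₁                   ≤⟨ +-monoˡ-≤ c₁ (+-monoʳ-≤ f₁ (+-monoʳ-≤ f₂ c₂≤c₁)) ⟩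
    f₁ + (f₂ + c₁) + c₁                   ≡⟨ rearrange f₁ f₂ c₁ ⟩
    f₂ + (f₁ + c₁) + c₁                   ≡⟨ cong (λ z → f₂ + z + c₁) (length-filter-complement P? (upTo n)) ⟨
    f₂ + length (upTo n) + c₁             ≡⟨ cong (λ z → f₂ + z + c₁) (length-upTo n) ⟩
    f₂ + n + c₁                           ∎)
    where
    open ≤-Reasoning
    f₁ = length (filter P? (upTo n))
    f₂ = length (filter P? xs)
    c₁ = length (filter (¬? ∘ P?) (upTo n))
    c₂ = length (filter (¬? ∘ P?) xs)
    l  = length xs
    c₂≤c₁ : c₂ ≤ c₁
    c₂≤c₁ = unique-⊆-length (Unique.filter⁺ (¬? ∘ P?) xs!) λ x∈ →
      let x∈xs , ¬Px = ∈-filter⁻ (¬? ∘ P?) {xs = xs} x∈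
      in ∈-filter⁺ (¬? ∘ P?) (∈-upTo⁺ (All.lookup xs<n x∈xs)) ¬Px
    rearrange : ∀ a b c → a + (b + c) + c ≡ b + (a + c) + c
    rearrange = solve-∀

  -- Chvátal-Erdős: at least `k + 2` neighbours of `x` on the cycle have at least `k + 1` successors
  -- along the path, too many to be independent; an edge between two of them gives a detour through
  -- `x`.
  insert : ∀ {xs x} → CycleOn xs → x < n → x ∉ xs → suc k < length (filter (E? x) xs) →
    ∃[ ys ] (CycleOn ys × ys ↭ x ∷ xs)
  insert {xs} {x} C x<n x∉xs many = result (detour-or-independent p)
    where
    open CycleOn C
    open Rotation E? E-sym E-irrefl (E? x)
    a = proj₁ closed
    z = proj₁ (proj₂ closed)
    p = proj₁ (proj₂ (proj₂ closed))
    za = proj₂ (proj₂ (proj₂ closed))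
    result : Detour a z xs ⊎ IsIndependent E (successors p) → ∃[ ys ] (CycleOn ys × ys ↭ x ∷ xs)
    result (inj₂ ind) = contradiction
      (bound (successors p) (successors-unique p unique)
        (All.tabulate (λ t∈ → All.lookup bounded (tail⊆ xs (successors⊆tail p t∈)))) ind)
      (<⇒≱ (s≤s⁻¹ (≤-trans many (length-successors p))))
    result (inj₁ d) = ys , record
      { closed  = a , z , join first (E-sym Pb)
                    (join (stop {x = x}) Pc (join (reversed E-sym second) b⁺c⁺ third)) , za
      ; unique  = unique-resp-↭ (↭-sym perm) (All.¬Any⇒All¬ xs x∉xs ∷ unique)
      ; bounded = All-resp-↭ (↭-sym perm) (x<n ∷ bounded)
      } , perm
      where
      open Detour d
      ys = S₀ ++ [ x ] ++ reverse S₁ ++ S₂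
      perm : ys ↭ x ∷ xs
      perm = ↭-trans (shift x S₀ (reverse S₁ ++ S₂)) (prep x
        (↭-trans (++⁺ˡ S₀ (++⁺ʳ S₂ (↭-reverse S₁))) (↭-reflexive (sym pieces))))

  -- With `suc m` vertices missing, each of them keeps at least `k + 2` neighbours on the cycle, as
  -- `insert` demands. `D` stays fixed, so the degree hypothesis survives each insertion.
  absorb-all-but-one : ∀ m {D xs} → k + 3 + m ≤ D → length xs + suc m ≡ n → CycleOn xs →
    (∀ {x} → x < n → x ∉ xs → D ≤ degree x) →
    ∃[ ys ] (CycleOn ys × suc (length ys) ≡ n)
  absorb-all-but-one zero {xs = xs} _ len C _ = xs , C , trans (sym (+-comm (length xs) 1)) len
  absorb-all-but-one (suc m) {D} {xs} D≥ len C high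
    with any? (λ x → ¬? (_∈?_ _≟_ x xs)) (upTo n)
  ... | no all∈ = contradiction
        (≤-trans (≤-reflexive (sym (length-upTo n))) (unique-⊆-length (Unique.upTo⁺ n) upTo⊆xs))
        (<⇒≱ (≤-trans (s≤s (m≤m+n (length xs) (suc m))) (≤-reflexive (trans (sym (+-suc _ _)) len))))
    where
    upTo⊆xs : upTo n ⊆ xs
    upTo⊆xs {x} x∈ = decidable-stable (_∈?_ _≟_ x xs) (λ x∉ → all∈ (lose x∈ x∉))
  ... | yes some with find some
  ... | x , x∈ , x∉xs with insert C (∈-upTo⁻ x∈) x∉xs many
    where
    open ≤-Reasoning
    open CycleOn C
    many : suc k < length (filter (E? x) xs)
    many = +-cancelʳ-≤ n _ _ (begin
      2 + k + n                                 ≡⟨ cong (2 + k +_) len ⟨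
      2 + k + (length xs + suc (suc m))         ≡⟨ rearrange k (length xs) m ⟩
      (k + 3 + suc m) + length xs
        ≤⟨ +-monoˡ-≤ (length xs) (≤-trans D≥ (high (∈-upTo⁻ x∈) x∉xs)) ⟩
      degree x + length xs                      ≤⟨ length-filter-⊆ (E? x) unique bounded ⟩
      length (filter (E? x) xs) + n             ∎)
      where
      rearrange : ∀ k l m → 2 + k + (l + suc (suc m)) ≡ (k + 3 + suc m) + l
      rearrange = solve-∀
  ... | ys , C′ , perm = absorb-all-but-one m (≤-trans (+-monoʳ-≤ (k + 3) (n≤1+n m)) D≥)
        (trans (cong (_+ suc m) (↭-length perm)) (trans (sym (+-suc (length xs) (suc m))) len))
        C′ (λ y<n y∉ys → high y<n (λ y∈xs → y∉ys (∈-resp-↭ (↭-sym perm) (there y∈xs))))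

-- Reconnecting the arcs of a cut cycle

-- xs lists, in increasing order, the numbers of [i, j) except d of them, all of which are High.
data Cover (High : Pred ℕ 0ℓ) : (i j d : ℕ) → List ℕ → Set where
  done : ∀ {i} → Cover High i i 0 []
  take : ∀ {i j d xs} → Cover High (suc i) j d xs → Cover High i j d (i ∷ xs)
  skip : ∀ {i j d xs} → High i → Cover High (suc i) j d xs → Cover High i j (suc d) xs

module _ {High : Pred ℕ 0ℓ} where

  infixr 5 _++ᶜ_
  _++ᶜ_ : ∀ {i j l d e xs ys} → Cover High i j d xs → Cover High j l e ys →
          Cover High i l (d + e) (xs ++ ys)
  done     ++ᶜ c′ = c′
  take c   ++ᶜ c′ = take (c ++ᶜ c′)
  skip h c ++ᶜ c′ = skip h (c ++ᶜ c′)

  cover-≤ : ∀ {i j d xs} → Cover High i j d xs → i ≤ j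
  cover-≤ done       = ≤-refl
  cover-≤ (take c)   = <⇒≤ (cover-≤ c)
  cover-≤ (skip _ c) = <⇒≤ (cover-≤ c)

  cover-length : ∀ {i j d xs} → Cover High i j d xs → length xs + d + i ≡ j
  cover-length done = refl
  cover-length {i} {d = d} (take {xs = xs} c) = trans (sym (+-suc (length xs + d) i)) (cover-length c)
  cover-length {i} (skip {d = d} {xs = xs} _ c) = trans (cong (_+ i) (+-suc (length xs) d))
    (trans (sym (+-suc (length xs + d) i)) (cover-length c))

  cover-lower : ∀ {i j d xs} → Cover High i j d xs → All (i ≤_) xs
  cover-lower done       = []
  cover-lower (take c)   = ≤-refl ∷ All.map <⇒≤ (cover-lower c)
  cover-lower (skip _ c) = All.map <⇒≤ (cover-lower c)

  cover-upper : ∀ {i j d xs} → Cover High i j d xs → All (_< j) xs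
  cover-upper done       = []
  cover-upper (take c)   = cover-≤ c ∷ cover-upper c
  cover-upper (skip _ c) = cover-upper c

  cover-unique : ∀ {i j d xs} → Cover High i j d xs → Unique xs
  cover-unique done       = []
  cover-unique (take c)   = All.map <⇒≢ (cover-lower c) ∷ cover-unique c
  cover-unique (skip _ c) = cover-unique c

  cover-missing : ∀ {i j d xs x} → Cover High i j d xs → i ≤ x → x < j → x ∉ xs → High x
  cover-missing done i≤x x<i _ = contradiction x<i (≤⇒≯ i≤x)
  cover-missing (take c) i≤x x<j x∉ with m≤n⇒m<n∨m≡n i≤x
  ... | inj₁ i<x  = cover-missing c i<x x<j (x∉ ∘ there)
  ... | inj₂ refl = contradiction (here refl) x∉
  cover-missing (skip h c) i≤x x<j x∉ with m≤n⇒m<n∨m≡n i≤x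
  ... | inj₁ i<x  = cover-missing c i<x x<j x∉
  ... | inj₂ refl = h

module Reconnection (n ℓ : ℕ) (High : Pred ℕ 0ℓ) {E : Rel ℕ 0ℓ} (E-sym : Symmetric E)
                    (consecutive : ∀ {i} → suc i < n → E i (suc i))
                    (closing : ∀ {m} → suc m ≡ n → E m 0) where

  -- `kept` is increasing, so `cover` yields its distinctness and range and that every missing
  -- vertex is `High`; `order` is how the cycle runs through it. The bound `4 * ℓ` allows four gaps
  -- of length at most `ℓ`.
  record Shortened : Set where
    field
      {kept order} : List ℕ
      {dropped}    : ℕ
      cover        : Cover High 0 n dropped kept
      same         : order ↭ kept
      closed       : ClosedPath E order
      dropped≥1    : 1 ≤ dropped
      dropped≤     : dropped ≤ 4 * ℓ

  Arc : ℕ → ℕ → List ℕ → Set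
  Arc i j xs = Cover High i (suc j) 0 xs × Path E i j xs

  arc : ∀ {i j} → i ≤ j → j < n → ∃[ xs ] Arc i j xs
  arc i≤j = go (≤⇒≤′ i≤j) (_ , take done , stop)
    where
    extend : ∀ {i j xs} → suc j < n → Arc i j xs → Arc i (suc j) (xs ++ [ suc j ])
    extend j<n (c , p) = (c ++ᶜ take done) , join p (consecutive j<n) stop
    go : ∀ {i j} → i ≤′ j → ∃[ xs ] Arc i i xs → j < n → ∃[ xs ] Arc i j xs
    go (≤′-reflexive refl) base _ = base
    go (≤′-step i≤j) base j<n = let xs , a = go i≤j base (<-trans (n<1+n _) j<n)
                                in _ , extend j<n a

  -- The walk can be interrupted after p and resumed at q.
  record Cut (p q : ℕ) : Set where
    field
      apart    : suc p < q
      short    : q ≤ p + ℓ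
      interior : ∀ {x} → p < x → x < q → High x

  gap : ∀ {p q} → Cut p q → ∃[ d ] (Cover High (suc p) q d [] × 1 ≤ d × d ≤ ℓ)
  gap {p} {q} cut = q ∸ suc p , subst (λ j → Cover High (suc p) j (q ∸ suc p) []) (m∸n+n≡m (<⇒≤ apart))
      (go (q ∸ suc p) ≤-refl (≤-reflexive (m∸n+n≡m (<⇒≤ apart)))) , m<n⇒0<n∸m apart ,
      ≤-trans (∸-monoʳ-≤ q (n≤1+n p)) (≤-trans (∸-monoˡ-≤ p short) (≤-reflexive (m+n∸m≡n p ℓ)))
    where
    open Cut cut
    go : ∀ d {i} → suc p ≤ i → d + i ≤ q → Cover High i (d + i) d []
    go zero    p<i d+i≤q = done
    go (suc d) {i} p<i d+i≤q =
      skip (interior p<i (≤-trans (s≤s (m≤n+m i d)) d+i≤q))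
        (subst (λ j → Cover High (suc i) j d []) (+-suc d i)
          (go d (m≤n⇒m≤1+n p<i) (≤-trans (≤-reflexive (+-suc d i)) d+i≤q)))

  last-arc : ∀ {q} → q < n → ∃[ m ] ∃[ xs ] (suc m ≡ n × Cover High q n 0 xs × Path E q m xs)
  last-arc {q} q<n with suc-pred n {{>-nonZero (≤-<-trans z≤n q<n)}}
  ... | eq = let q≤ = s≤s⁻¹ (≤-trans q<n (≤-reflexive (sym eq)))
                 xs , c , path = arc {q} {pred n} q≤ (≤-reflexive eq)
             in pred n , xs , eq , subst (λ j → Cover High q j 0 xs) eq c , path

  shortcut : ∀ {p q} → Cut p q → q < n → E p q → Shortened
  shortcut {p} {q} cut q<n pq
    with arc {0} {p} z≤n (<-trans (<-trans (n<1+n p) (Cut.apart cut)) q<n) | gap cut | last-arc q<n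
  ... | S₀ , c₀ , π₀ | d , g , d≥1 , d≤ℓ | m , S₁ , m+1≡n , c₁ , π₁ = record
    { cover = c₀ ++ᶜ g ++ᶜ c₁ ; same = ↭-refl
    ; closed = _ , _ , join π₀ pq π₁ , closing m+1≡n
    ; dropped≥1 = ≤-trans d≥1 (m≤m+n d 0)
    ; dropped≤ = ≤-trans (≤-reflexive (+-identityʳ d)) (≤-trans d≤ℓ (m≤m+n ℓ _)) }

  -- The closing edge ties `S₄` to `S₀`, so every tour below runs from `S₀` to `S₄` and only
  -- permutes and reverses the three arcs between. In each tour exactly one of the two matchings is
  -- the crossing one, `AC` with `BD`.
  module FourCuts {pA qA pB qB pC qC pD qD : ℕ}
    (cutA : Cut pA qA) (cutB : Cut pB qB) (cutC : Cut pC qC) (cutD : Cut pD qD)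
    (AB : qA ≤ pB) (BC : qB ≤ pC) (CD : qC ≤ pD) (qD<n : qD < n) where
    private
      cut-< : ∀ {p q} → Cut p q → p < q
      cut-< c = <-trans (n<1+n _) (Cut.apart c)
      pD<n = <-trans (cut-< cutD) qD<n
      pC<n = <-trans (<-≤-trans (cut-< cutC) CD) pD<n
      pB<n = <-trans (<-≤-trans (cut-< cutB) BC) pC<n
      pA<n = <-trans (<-≤-trans (cut-< cutA) AB) pB<n

      arc₀ = arc {0} z≤n pA<n
      arc₁ = arc AB pB<n
      arc₂ = arc BC pC<n
      arc₃ = arc CD pD<n
      arc₄ = last-arc qD<n
      S₀ = proj₁ arc₀
      S₁ = proj₁ arc₁
      S₂ = proj₁ arc₂
      S₃ = proj₁ arc₃
      S₄ = proj₁ (proj₂ arc₄)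
      π₀ = proj₂ (proj₂ arc₀)
      π₁ = proj₂ (proj₂ arc₁)
      π₂ = proj₂ (proj₂ arc₂)
      π₃ = proj₂ (proj₂ arc₃)
      π₄ = proj₂ (proj₂ (proj₂ (proj₂ arc₄)))
      reversed₁ = reversed E-sym π₁
      reversed₂ = reversed E-sym π₂
      reversed₃ = reversed E-sym π₃
      close = closing (proj₁ (proj₂ (proj₂ arc₄)))

      kept = S₀ ++ S₁ ++ S₂ ++ S₃ ++ S₄

      shortened : ∀ {order} → order ↭ kept → ClosedPath E order → Shortened
      shortened {order} same closed with gap cutA | gap cutB | gap cutC | gap cutD
      ... | a , gA , a≥1 , a≤ | b , gB , _ , b≤ | c , gC , _ , c≤ | d , gD , _ , d≤ = record
        { cover = proj₁ (proj₂ arc₀) ++ᶜ gA ++ᶜ proj₁ (proj₂ arc₁) ++ᶜ gB ++ᶜ proj₁ (proj₂ arc₂)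
            ++ᶜ gC ++ᶜ proj₁ (proj₂ arc₃) ++ᶜ gD ++ᶜ proj₁ (proj₂ (proj₂ (proj₂ arc₄)))
        ; same = same ; closed = closed
        ; dropped≥1 = ≤-trans a≥1 (m≤m+n a _)
        ; dropped≤ = +-mono-≤ a≤ (+-mono-≤ b≤ (+-mono-≤ c≤ (+-mono-≤ d≤ z≤n))) }

      unreverse : ∀ (xs : List ℕ) {ys zs} → ys ↭ zs → reverse xs ++ ys ↭ xs ++ zs
      unreverse xs = ++⁺ (↭-reverse xs)

    -- In each name, the chords at the points p come first, then those at the points q.
    AC-BD-AB-CD : E pA pC → E pB pD → E qA qB → E qC qD → Shortened
    AC-BD-AB-CD AC BD AB CD = shortened {S₀ ++ reverse S₂ ++ S₁ ++ reverse S₃ ++ S₄}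
      (++⁺ˡ S₀ (↭-trans (unreverse S₂ (++⁺ˡ S₁ (unreverse S₃ ↭-refl))) (shifts S₂ S₁)))
      (_ , _ , join π₀ AC (join reversed₂ (E-sym AB) (join π₁ BD (join reversed₃ CD π₄))) , close)

    AB-CD-AC-BD : E pA pB → E pC pD → E qA qC → E qB qD → Shortened
    AB-CD-AC-BD AB CD AC BD = shortened {S₀ ++ reverse S₁ ++ S₃ ++ reverse S₂ ++ S₄}
      (++⁺ˡ S₀ (unreverse S₁ (↭-trans (++⁺ˡ S₃ (unreverse S₂ ↭-refl)) (shifts S₃ S₂))))
      (_ , _ , join π₀ AB (join reversed₁ AC (join π₃ (E-sym CD) (join reversed₂ BD π₄))) , close)

    AC-BD-AD-BC : E pA pC → E pB pD → E qA qD → E qB qC → Shortened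
    AC-BD-AD-BC AC BD AD BC = shortened {S₀ ++ reverse S₂ ++ S₃ ++ reverse S₁ ++ S₄}
      (++⁺ˡ S₀ (↭-trans (unreverse S₂ (↭-trans (++⁺ˡ S₃ (unreverse S₁ ↭-refl)) (shifts S₃ S₁)))
        (shifts S₂ S₁)))
      (_ , _ , join π₀ AC (join reversed₂ BC (join π₃ (E-sym BD) (join reversed₁ AD π₄))) , close)

    AD-BC-AC-BD : E pA pD → E pB pC → E qA qC → E qB qD → Shortened
    AD-BC-AC-BD AD BC AC BD = shortened {S₀ ++ reverse S₃ ++ S₁ ++ reverse S₂ ++ S₄}
      (++⁺ˡ S₀ (↭-trans (unreverse S₃ (++⁺ˡ S₁ (unreverse S₂ ↭-refl)))
        (↭-trans (shifts S₃ S₁) (++⁺ˡ S₁ (shifts S₃ S₂)))))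
      (_ , _ , join π₀ AD (join reversed₃ (E-sym AC) (join π₁ BC (join reversed₂ BD π₄))) , close)

-- Blocks of consecutive positions

length-cartesianProductWith : {A B C : Set} (f : A → B → C) (xs : List A) (ys : List B) →
  length (cartesianProductWith f xs ys) ≡ length xs * length ys
length-cartesianProductWith f []       ys = refl
length-cartesianProductWith f (x ∷ xs) ys = trans (length-++ (map (f x) ys))
  (cong₂ _+_ (length-map (f x) ys) (length-cartesianProductWith f xs ys))

record OrderedPattern (R₁ R₂ : Rel ℕ 0ℓ) (B : List ℕ) : Set where
  field
    pattern′ : Pattern R₁ R₂ B
  open Pattern pattern′ public
  field
    w<y  : w < y
    v<v′ : v < v′
    w<v  : w < v

-- A pattern survives exchanging `w` with `y`, `v` with `v′`, and the two pairs, so `w` may be taken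
-- least. Only the place of `y` relative to `v` and `v′` stays open.
order-pattern : ∀ {R₁ R₂ : Rel ℕ 0ℓ} {B} → Symmetric R₁ → Symmetric R₂ →
  (∀ {x y} → R₁ x y → x ≢ y) → (∀ {x y} → R₂ x y → x ≢ y) →
  Pattern R₁ R₂ B → OrderedPattern R₁ R₂ B
order-pattern {R₁} {R₂} {B} R₁-sym R₂-sym R₁≢ R₂≢ = order-wy
  where
  swap-wy swap-vv′ swap-pairs : Pattern R₁ R₂ B → Pattern R₁ R₂ B
  swap-wy p = record
    { w∈ = y∈ ; y∈ = w∈ ; v∈ = v∈ ; v′∈ = v′∈ ; wy = R₂-sym wy ; vv′ = vv′
    ; vw = vy ; vy = vw ; v′w = v′y ; v′y = v′w }
    where open Pattern p
  swap-vv′ p = record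
    { w∈ = w∈ ; y∈ = y∈ ; v∈ = v′∈ ; v′∈ = v∈ ; wy = wy ; vv′ = R₂-sym vv′
    ; vw = v′w ; vy = v′y ; v′w = vw ; v′y = vy }
    where open Pattern p
  swap-pairs p = record
    { w∈ = v∈ ; y∈ = v′∈ ; v∈ = w∈ ; v′∈ = y∈ ; wy = vv′ ; vv′ = wy
    ; vw = R₁-sym vw ; vy = R₁-sym v′w ; v′w = R₁-sym vy ; v′y = R₁-sym v′y }
    where open Pattern p
  order-pairs : (p : Pattern R₁ R₂ B) → Pattern.w p < Pattern.y p → Pattern.v p < Pattern.v′ p →
    OrderedPattern R₁ R₂ B
  order-pairs p w<y v<v′ with <-cmp (Pattern.w p) (Pattern.v p)
  ... | tri< w<v _ _ = record { pattern′ = p ; w<y = w<y ; v<v′ = v<v′ ; w<v = w<v }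
  ... | tri≈ _ w≡v _ = contradiction (sym w≡v) (R₁≢ (Pattern.vw p))
  ... | tri> _ _ v<w = record { pattern′ = swap-pairs p ; w<y = v<v′ ; v<v′ = w<y ; w<v = v<w }
  order-vv′ : (p : Pattern R₁ R₂ B) → Pattern.w p < Pattern.y p → OrderedPattern R₁ R₂ B
  order-vv′ p w<y with <-cmp (Pattern.v p) (Pattern.v′ p)
  ... | tri< v<v′ _ _ = order-pairs p w<y v<v′
  ... | tri≈ _ v≡v′ _ = contradiction v≡v′ (R₂≢ (Pattern.vv′ p))
  ... | tri> _ _ v′<v = order-pairs (swap-vv′ p) w<y v′<v
  order-wy : Pattern R₁ R₂ B → OrderedPattern R₁ R₂ B
  order-wy p with <-cmp (Pattern.w p) (Pattern.y p)
  ... | tri< w<y _ _ = order-vv′ p w<y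
  ... | tri≈ _ w≡y _ = contradiction w≡y (R₂≢ (Pattern.wy p))
  ... | tri> _ _ y<w = order-vv′ (swap-wy p) y<w

module Positions
  (n k : ℕ) {E : Rel ℕ 0ℓ} (E? : Decidable E) (E-sym : Symmetric E) (E-irrefl : ∀ {x} → ¬ E x x)
  (bound : IndependenceBound E (_< n) k)
  (consecutive : ∀ {i} → suc i < n → E i (suc i)) (closing : ∀ {m} → suc m ≡ n → E m 0)
  where
  open Absorption n k E? E-sym E-irrefl bound

  -- A greedy independent set in `S` has at most `k` vertices, and the rest of `S` lies among their
  -- neighbours, at most `d` for each: at most `k + k * d` in all.
  few-of-small-degree : ∀ {d S} → Unique S → All (_< n) S → All (λ x → degree x ≤ d) S →
    length S ≤ k * suc d
  few-of-small-degree {d} {S} S! S<n small = begin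
    length S                              ≡⟨ trans (↭-length partition) (length-++ I) ⟩
    length I + length J
      ≤⟨ +-monoʳ-≤ (length I) (≤-trans |J|≤ (neighbours-length I smallI)) ⟩
    length I + length I * d               ≡⟨ *-suc (length I) d ⟨
    length I * suc d                      ≤⟨ *-monoˡ-≤ (suc d) (bound I (proj₁ parts!) I<n independent) ⟩
    k * suc d                             ∎
    where
    open ≤-Reasoning
    open EdgeCount E?
    open Domination (dominate E-sym E-irrefl S)
    parts! : Unique I × Unique J
    parts! = unique-++⁻ I (unique-resp-↭ partition S!)
    IJ<n : All (_< n) (I ++ J)
    IJ<n = All-resp-↭ partition S<n
    I<n = All.++⁻ˡ I IJ<n
    smallI = All.++⁻ˡ I (All-resp-↭ partition small)
    neighbours : List ℕ → List ℕ
    neighbours []      = []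
    neighbours (x ∷ I) = filter (E? x) (upTo n) ++ neighbours I
    neighbours-length : ∀ I → All (λ x → degree x ≤ d) I → length (neighbours I) ≤ length I * d
    neighbours-length []      []        = z≤n
    neighbours-length (x ∷ I) (dx ∷ dI) =
      ≤-trans (≤-reflexive (length-++ (filter (E? x) (upTo n)))) (+-mono-≤ dx (neighbours-length I dI))
    ∈-neighbours : ∀ {x I} → x < n → Any (E x) I → x ∈ neighbours I
    ∈-neighbours {x} {i ∷ I} x<n (here xi) = ∈-++⁺ˡ (∈-filter⁺ (E? i) (∈-upTo⁺ x<n) (E-sym xi))
    ∈-neighbours {x} {i ∷ I} x<n (there r) = ∈-++⁺ʳ (filter (E? i) (upTo n)) (∈-neighbours x<n r)
    |J|≤ : length J ≤ length (neighbours I)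
    |J|≤ = unique-⊆-length (proj₂ parts!) λ x∈J →
      ∈-neighbours (All.lookup (All.++⁻ʳ I IJ<n) x∈J) (All.lookup dominated x∈J)

  -- At most four gaps of length `4 * s`, with `s ≤ k`, are dropped, so at most `16 * k` vertices;
  -- `absorb-all-but-one` asks for degree `k + 3 + m` when `suc m` are missing.
  threshold : ℕ
  threshold = k + 3 + 16 * k

  High : Pred ℕ 0ℓ
  High x = threshold ≤ degree x

  High? : ∀ x → Dec (High x)
  High? x = threshold ≤? degree x

  -- `suc a` bounds the number of blocks that can each supply `s` vertices to one independent set.
  -- In `large`, the term `k * threshold` pays for the blocks containing a vertex that is not
  -- `High`.
  module Blocks
    {s M a : ℕ} (s≤k : s ≤ k) (a-max : ∀ m → m * s ≤ k → m ≤ suc a)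
    (fit : M * (4 * s) ≤ n)
    (large : suc a * (suc a * suc (suc a) + 1) + k * threshold < M)
    where

    ℓ = 4 * s
    open Reconnection n ℓ High {E = E} E-sym consecutive closing

    block-< : ∀ {b b′ i j} → b < b′ → i < ℓ → b * ℓ + i < b′ * ℓ + j
    block-< {b} {b′} {i} {j} b<b′ i<ℓ = begin-strict
      b * ℓ + i    <⟨ +-monoʳ-< (b * ℓ) i<ℓ ⟩
      b * ℓ + ℓ    ≡⟨ +-comm (b * ℓ) ℓ ⟩
      suc b * ℓ    ≤⟨ *-monoˡ-≤ ℓ b<b′ ⟩
      b′ * ℓ       ≤⟨ m≤m+n (b′ * ℓ) j ⟩
      b′ * ℓ + j   ∎
      where open ≤-Reasoning

    block-injective : ∀ {b b′ i j} → i < ℓ → j < ℓ → b * ℓ + i ≡ b′ * ℓ + j → b ≡ b′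
    block-injective {b} {b′} i<ℓ j<ℓ eq with <-cmp b b′
    ... | tri< b<b′ _ _ = contradiction eq (<⇒≢ (block-< b<b′ i<ℓ))
    ... | tri≈ _ b≡b′ _ = b≡b′
    ... | tri> _ _ b′<b = contradiction (sym eq) (<⇒≢ (block-< b′<b j<ℓ))

    block-fits : ∀ {b i} → b < M → i < ℓ → b * ℓ + i < n
    block-fits b<M i<ℓ = <-≤-trans (block-< b<M i<ℓ) (≤-trans (≤-reflexive (+-identityʳ _)) fit)

    HasLow : Pred ℕ 0ℓ
    HasLow b = ∃[ i ] (i < ℓ × ¬ High (b * ℓ + i))

    hasLow? : ∀ b → Dec (HasLow b)
    hasLow? b = anyUpTo? (λ i → ¬? (High? (b * ℓ + i))) ℓ

    goods : List ℕ
    goods = filter (¬? ∘ hasLow?) (upTo M)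

    good-< : ∀ {b} → b ∈ goods → b < M
    good-< b∈ = ∈-upTo⁻ (proj₁ (∈-filter⁻ (¬? ∘ hasLow?) b∈))

    good-high : ∀ {b i} → b ∈ goods → i < ℓ → High (b * ℓ + i)
    good-high {b} {i} b∈ i<ℓ = decidable-stable (High? _)
      (λ low → proj₂ (∈-filter⁻ (¬? ∘ hasLow?) {xs = upTo M} b∈) (i , i<ℓ , low))

    goods! : Unique goods
    goods! = Unique.filter⁺ (¬? ∘ hasLow?) (Unique.upTo⁺ M)

    many-goods : suc a * (suc a * suc (suc a) + 1) < length goods
    many-goods = +-cancelʳ-< (k * threshold) _ _ (begin-strict
      suc a * (suc a * suc (suc a) + 1) + k * threshold   <⟨ large ⟩
      M                                                   ≡⟨ length-upTo M ⟨
      length (upTo M)                                     ≡⟨ length-filter-complement hasLow? (upTo M) ⟩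
      length bads + length goods                          ≤⟨ +-monoˡ-≤ (length goods) few-bads ⟩
      k * threshold + length goods                        ≡⟨ +-comm (k * threshold) _ ⟩
      length goods + k * threshold                        ∎)
      where
      open ≤-Reasoning
      bads = filter hasLow? (upTo M)
      bads! : Unique bads
      bads! = Unique.filter⁺ hasLow? (Unique.upTo⁺ M)
      -- Selects one low vertex per bad block. The value 0 is a dummy, never reached on `bads`.
      offset : ∀ b → Dec (HasLow b) → ℕ
      offset b (yes (i , _)) = i
      offset b (no _)        = 0
      offset-low : ∀ b (d : Dec (HasLow b)) → HasLow b → offset b d < ℓ × ¬ High (b * ℓ + offset b d)
      offset-low b (yes (_ , i<ℓ , low)) _ = i<ℓ , low
      offset-low b (no none)             h = contradiction h none
      witness : ℕ → ℕ
      witness b = b * ℓ + offset b (hasLow? b)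
      bads-low : ∀ {b} → b ∈ bads → offset b (hasLow? b) < ℓ × ¬ High (witness b)
      bads-low {b} b∈ = offset-low b (hasLow? b) (proj₂ (∈-filter⁻ hasLow? {xs = upTo M} b∈))
      witnesses! : Unique (map witness bads)
      witnesses! = unique-map⁺
        (λ b∈ b′∈ → block-injective (proj₁ (bads-low b∈)) (proj₁ (bads-low b′∈))) bads!
      few-bads : length bads ≤ k * threshold
      few-bads = ≤-trans (≤-reflexive (sym (length-map witness bads)))
        -- Failing `High` means degree at most `threshold` minus one, which is this `d`.
        (≤-trans (few-of-small-degree {d = k + 2 + 16 * k} witnesses!
          (All.map⁺ (All.tabulate λ b∈ →
            block-fits (∈-upTo⁻ (proj₁ (∈-filter⁻ hasLow? b∈))) (proj₁ (bads-low b∈))))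
          (All.map⁺ (All.tabulate λ b∈ →
            s≤s⁻¹ (≤-trans (≰⇒> (proj₂ (bads-low b∈))) (≤-reflexive (threshold≡ k))))))
          (≤-reflexive (cong (k *_) (sym (threshold≡ k)))))
        where
        threshold≡ : ∀ k → k + 3 + 16 * k ≡ suc (k + 2 + 16 * k)
        threshold≡ = solve-∀

    -- The parts at offsets 0 and 2 s consist of s pairwise non-consecutive positions of a block.
    position : ℕ → ℕ → ℕ → ℕ
    position o b i = b * ℓ + (o + 2 * i)

    record Adjacent (o b b′ : ℕ) : Set where
      constructor adjacent
      field
        {i j} : ℕ
        i<s   : i < s
        j<s   : j < s
        edge  : E (position o b i) (position o b′ j)

    adjacent? : ∀ o → Decidable (Adjacent o)
    adjacent? o b b′ = map′
      (λ (_ , i<s , _ , j<s , e) → adjacent i<s j<s e)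
      (λ (adjacent i<s j<s e) → _ , i<s , _ , j<s , e)
      (anyUpTo? (λ i → anyUpTo? (λ j → E? (position o b i) (position o b′ j)) s) s)

    adjacent-sym : ∀ o → Symmetric (Adjacent o)
    adjacent-sym o (adjacent i<s j<s e) = adjacent j<s i<s (E-sym e)

    -- Equal blocks are excluded to make the relation irreflexive, as the edge counts require; a
    -- block adjacent to itself is handled by `adjacent-self⇒shortened`.
    Chord : ℕ → Rel ℕ 0ℓ
    Chord o b b′ = b ≢ b′ × Adjacent o b b′

    chord? : ∀ o → Decidable (Chord o)
    chord? o b b′ = ¬? (b ≟ b′) ×-dec adjacent? o b b′

    chord-sym : ∀ o → Symmetric (Chord o)
    chord-sym o (b≢b′ , adj) = (λ b′≡b → b≢b′ (sym b′≡b)) , adjacent-sym o adj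

    offset-< : ∀ {o i} → o ≤ 2 * s → i < s → o + 2 * i < ℓ
    offset-< {o} {i} o≤ i<s = begin-strict
      o + 2 * i        <⟨ +-mono-≤-< o≤ (*-monoʳ-< 2 i<s) ⟩
      2 * s + 2 * s    ≡⟨ double s ⟩
      ℓ                ∎
      where
      open ≤-Reasoning
      double : ∀ s → 2 * s + 2 * s ≡ 4 * s
      double = solve-∀

    cut : ∀ {b i j} → b ∈ goods → suc i < j → j < ℓ → Cut (b * ℓ + i) (b * ℓ + j)
    cut {b} {i} {j} b∈ i+1<j j<ℓ = record
      { apart = ≤-trans (≤-reflexive (sym (trans (+-suc (b * ℓ) (suc i)) (cong suc (+-suc (b * ℓ) i)))))
                  (+-monoʳ-≤ (b * ℓ) i+1<j)
      ; short = ≤-trans (<⇒≤ (+-monoʳ-< (b * ℓ) j<ℓ)) (+-monoˡ-≤ ℓ (m≤m+n (b * ℓ) i))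
      ; interior = λ {x} p<x x<q →
          let b*ℓ≤x = ≤-trans (m≤m+n (b * ℓ) i) (<⇒≤ p<x)
              eq = m+[n∸m]≡n b*ℓ≤x
              x-bℓ<j = +-cancelˡ-< (b * ℓ) _ _ (subst (_< b * ℓ + j) (sym eq) x<q)
          in subst High eq (good-high b∈ (<-trans x-bℓ<j j<ℓ)) }

    spaced : ∀ {o i j} → i < j → suc (o + 2 * i) < o + 2 * j
    spaced {o} {i} i<j = ≤-trans (≤-reflexive (shift-by-2 o i)) (+-monoʳ-≤ o (*-monoʳ-≤ 2 i<j))
      where
      shift-by-2 : ∀ o i → suc (suc (o + 2 * i)) ≡ o + 2 * suc i
      shift-by-2 = solve-∀

    -- Chosen positions in one half are never consecutive, so the chord jumps over at least one
    -- vertex, and all those it skips lie in a good block.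
    adjacent-self⇒shortened : ∀ {o b} → o ≤ 2 * s → b ∈ goods → Adjacent o b b → Shortened
    adjacent-self⇒shortened {o} {b} o≤ b∈ (adjacent {i} {j} i<s j<s e) with <-cmp i j
    ... | tri≈ _ refl _ = contradiction e E-irrefl
    ... | tri< i<j _ _ =
      shortcut (cut b∈ (spaced {o} i<j) (offset-< o≤ j<s)) (block-fits (good-< b∈) (offset-< o≤ j<s)) e
    ... | tri> _ _ j<i =
      shortcut (cut b∈ (spaced {o} j<i) (offset-< o≤ i<s)) (block-fits (good-< b∈) (offset-< o≤ i<s))
        (E-sym e)

    -- With no chord inside a half, the chosen positions of pairwise unjoined blocks form an
    -- independent set of `length I * s` vertices, hence at most `k`.
    chord-bound : ∀ {o} → o ≤ 2 * s → (∀ {b} → b ∈ goods → ¬ Adjacent o b b) →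
      IndependenceBound (Chord o) (_∈ goods) (suc a)
    chord-bound {o} o≤ no-inner I I! I⊆goods ind = a-max (length I) (begin
      length I * s               ≡⟨ cong (length I *_) (length-tabulate {n = s} id) ⟨
      length I * length (allFin s)   ≡⟨ length-cartesianProductWith at I (allFin s) ⟨
      length points              ≤⟨ bound points points! points<n points-independent ⟩
      k                          ∎)
      where
      open ≤-Reasoning
      at : ℕ → Fin s → ℕ
      at b i = position o b (toℕ i)
      points = cartesianProductWith at I (allFin s)
      at-injective : ∀ {b b′ i j} → at b i ≡ at b′ j → b ≡ b′ × i ≡ j
      at-injective {b} {b′} {i} {j} eq
        with block-injective {b} {b′} (offset-< o≤ (toℕ<n i)) (offset-< o≤ (toℕ<n j)) eq
      ... | refl = refl , toℕ-injective
        (*-cancelˡ-≡ _ _ 2 (+-cancelˡ-≡ o _ _ (+-cancelˡ-≡ (b * ℓ) _ _ eq)))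
      points! = Unique.cartesianProductWith⁺ at at-injective I! (Unique.allFin⁺ s)
      points<n : All (_< n) points
      points<n = All.tabulate λ p∈ → below (∈-cartesianProductWith⁻ at I (allFin s) p∈)
        where
        below : ∀ {p} → ∃[ b ] ∃[ i ] (b ∈ I × i ∈ allFin s × p ≡ at b i) → p < n
        below (b , i , b∈ , _ , refl) =
          block-fits (good-< (All.lookup I⊆goods b∈)) (offset-< o≤ (toℕ<n i))
      points-independent : IsIndependent E points
      points-independent p∈ q∈ e
        with ∈-cartesianProductWith⁻ at I (allFin s) p∈ | ∈-cartesianProductWith⁻ at I (allFin s) q∈
      ... | b , i , b∈ , _ , refl | b′ , j , b′∈ , _ , refl = separate (b ≟ b′)
        where
        adj : Adjacent o b b′
        adj = adjacent (toℕ<n i) (toℕ<n j) e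
        separate : ¬ Dec (b ≡ b′)
        separate (yes refl) = no-inner (All.lookup I⊆goods b∈) adj
        separate (no b≢b′)  = ind b∈ b′∈ (b≢b′ , adj)

    L R : Rel ℕ 0ℓ
    L = Adjacent 0
    R = Adjacent (2 * s)

    -- Each cut runs from the left half to the right half of one block, so `L`-edges join points
    -- where the walk is interrupted and `R`-edges join points where it resumes.
    module Quadruple {A B C D : ℕ} (A∈ : A ∈ goods) (B∈ : B ∈ goods) (C∈ : C ∈ goods) (D∈ : D ∈ goods)
                     (A<B : A < B) (B<C : B < C) (C<D : C < D) where
      private
        left-right : ∀ {b i j} → b ∈ goods → i < s → j < s → Cut (position 0 b i) (position (2 * s) b j)
        left-right {b} {i} {j} b∈ i<s j<s = cut b∈
          -- A left offset is at most `2 * s - 2` and a right one at least `2 * s`, so some vertex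
          -- lies strictly between.
          (≤-trans (≤-trans (≤-reflexive (double i)) (*-monoʳ-≤ 2 i<s)) (m≤m+n (2 * s) (2 * j)))
          (offset-< ≤-refl j<s)
          where
          double : ∀ i → suc (suc (0 + 2 * i)) ≡ 2 * suc i
          double = solve-∀
        before : ∀ {b b′ j} i → b < b′ → j < s → position (2 * s) b j ≤ position 0 b′ i
        before i b<b′ j<s = <⇒≤ (block-< b<b′ (offset-< ≤-refl j<s))

        module Cuts {iA jA iB jB iC jC iD jD : ℕ}
                    (iA< : iA < s) (jA< : jA < s) (iB< : iB < s) (jB< : jB < s)
                    (iC< : iC < s) (jC< : jC < s) (iD< : iD < s) (jD< : jD < s) =
          FourCuts (left-right A∈ iA< jA<) (left-right B∈ iB< jB<)
            (left-right C∈ iC< jC<) (left-right D∈ iD< jD<)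
            (before iB A<B jA<) (before iC B<C jB<) (before iD C<D jC<)
            (block-fits (good-< D∈) (offset-< ≤-refl jD<))

      L-AC-BD-R-AB-CD : L A C → L B D → R A B → R C D → Shortened
      L-AC-BD-R-AB-CD (adjacent iA iC ac) (adjacent iB iD bd) (adjacent jA jB ab) (adjacent jC jD cd) =
        Cuts.AC-BD-AB-CD iA jA iB jB iC jC iD jD ac bd ab cd

      L-AB-CD-R-AC-BD : L A B → L C D → R A C → R B D → Shortened
      L-AB-CD-R-AC-BD (adjacent iA iB ab) (adjacent iC iD cd) (adjacent jA jC ac) (adjacent jB jD bd) =
        Cuts.AB-CD-AC-BD iA jA iB jB iC jC iD jD ab cd ac bd

      L-AC-BD-R-AD-BC : L A C → L B D → R A D → R B C → Shortened
      L-AC-BD-R-AD-BC (adjacent iA iC ac) (adjacent iB iD bd) (adjacent jA jD ad) (adjacent jB jC bc) =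
        Cuts.AC-BD-AD-BC iA jA iB jB iC jC iD jD ac bd ad bc

      L-AD-BC-R-AC-BD : L A D → L B C → R A C → R B D → Shortened
      L-AD-BC-R-AC-BD (adjacent iA iD ad) (adjacent iB iC bc) (adjacent jA jC ac) (adjacent jB jD bd) =
        Cuts.AD-BC-AC-BD iA jA iB jB iC jC iD jD ad bc ac bd

    private
      symL = adjacent-sym 0
      symR = adjacent-sym (2 * s)

    -- `wy` and `vv′` cross exactly in the order `w`, `v`, `y`, `v′`, where the matching `wv`, `yv′`
    -- does not. In the order `w`, `y`, `v`, `v′` that same matching crosses; in the nested order
    -- `w`, `v`, `v′`, `y` the matching `wv′`, `vy` does.
    left-cross : Pattern (Chord 0) (Chord (2 * s)) goods → Shortened
    left-cross p with order-pattern (chord-sym 0) (chord-sym (2 * s)) proj₁ proj₁ p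
    ... | o = cases (<-cmp y v) (<-cmp y v′)
      where
      open OrderedPattern o
      cases : Tri (y < v) (y ≡ v) (v < y) → Tri (y < v′) (y ≡ v′) (v′ < y) → Shortened
      cases (tri< y<v _ _) _ = Quadruple.L-AC-BD-R-AB-CD w∈ y∈ v∈ v′∈ w<y y<v v<v′
        (symL (proj₂ vw)) (symL (proj₂ v′y)) (proj₂ wy) (proj₂ vv′)
      cases (tri≈ _ y≡v _) _ = contradiction (sym y≡v) (proj₁ vy)
      cases (tri> _ _ v<y) (tri< y<v′ _ _) = Quadruple.L-AB-CD-R-AC-BD w∈ v∈ y∈ v′∈ w<v v<y y<v′
        (symL (proj₂ vw)) (symL (proj₂ v′y)) (proj₂ wy) (proj₂ vv′)
      cases (tri> _ _ v<y) (tri≈ _ y≡v′ _) = contradiction (sym y≡v′) (proj₁ v′y)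
      cases (tri> _ _ v<y) (tri> _ _ v′<y) = Quadruple.L-AC-BD-R-AD-BC w∈ v∈ v′∈ y∈ w<v v<v′ v′<y
        (symL (proj₂ v′w)) (proj₂ vy) (proj₂ wy) (proj₂ vv′)

    right-cross : Pattern (Chord (2 * s)) (Chord 0) goods → Shortened
    right-cross p with order-pattern (chord-sym (2 * s)) (chord-sym 0) proj₁ proj₁ p
    ... | o = cases (<-cmp y v) (<-cmp y v′)
      where
      open OrderedPattern o
      cases : Tri (y < v) (y ≡ v) (v < y) → Tri (y < v′) (y ≡ v′) (v′ < y) → Shortened
      cases (tri< y<v _ _) _ = Quadruple.L-AB-CD-R-AC-BD w∈ y∈ v∈ v′∈ w<y y<v v<v′
        (proj₂ wy) (proj₂ vv′) (symR (proj₂ vw)) (symR (proj₂ v′y))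
      cases (tri≈ _ y≡v _) _ = contradiction (sym y≡v) (proj₁ vy)
      cases (tri> _ _ v<y) (tri< y<v′ _ _) = Quadruple.L-AC-BD-R-AB-CD w∈ v∈ y∈ v′∈ w<v v<y y<v′
        (proj₂ wy) (proj₂ vv′) (symR (proj₂ vw)) (symR (proj₂ v′y))
      cases (tri> _ _ v<y) (tri≈ _ y≡v′ _) = contradiction (sym y≡v′) (proj₁ v′y)
      cases (tri> _ _ v<y) (tri> _ _ v′<y) = Quadruple.L-AD-BC-R-AC-BD w∈ v∈ v′∈ y∈ w<v v<v′ v′<y
        (proj₂ wy) (proj₂ vv′) (symR (proj₂ v′w)) (proj₂ vy)

    shortened : Shortened
    shortened with any? (λ b → adjacent? 0 b b) goods | any? (λ b → adjacent? (2 * s) b b) goods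
    ... | yes some | _ = let b , b∈ , adj = find some in adjacent-self⇒shortened z≤n b∈ adj
    ... | no _ | yes some = let b , b∈ , adj = find some in adjacent-self⇒shortened ≤-refl b∈ adj
    -- The denser graph plays `R₁`, so the matching is chosen in it.
    ... | no no-left | no no-right = by-density (≤-total (edgeCount (2 * s)) (edgeCount 0))
      where
      edgeCount : ℕ → ℕ
      edgeCount o = EdgeCount.edges (chord? o) goods
      boundL = chord-bound z≤n (λ b∈ adj → no-left (lose b∈ adj))
      boundR = chord-bound ≤-refl (λ b∈ adj → no-right (lose b∈ adj))
      ok : All (_∈ goods) goods
      ok = All.tabulate id
      irrefl : ∀ {o b} → ¬ Chord o b b
      irrefl (b≢b , _) = b≢b refl
      by-density : edgeCount (2 * s) ≤ edgeCount 0 ⊎ edgeCount 0 ≤ edgeCount (2 * s) → Shortened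
      by-density (inj₁ R≤L) = left-cross (FindPattern.find-pattern goods! ok many-goods
        (chord? 0) (chord? (2 * s)) (chord-sym 0) (chord-sym (2 * s)) irrefl irrefl boundL boundR R≤L)
      by-density (inj₂ L≤R) = right-cross (FindPattern.find-pattern goods! ok many-goods
        (chord? (2 * s)) (chord? 0) (chord-sym (2 * s)) (chord-sym 0) irrefl irrefl boundR boundL L≤R)

    almost-spanning-cycle : ∃[ ys ] (CycleOn ys × suc (length ys) ≡ n)
    almost-spanning-cycle with shortened
    ... | record { dropped = zero ; dropped≥1 = () }
    ... | record { dropped = suc m ; cover = cover ; same = same
                 ; closed = closed ; dropped≤ = dropped≤ } =
      absorb-all-but-one m (+-monoʳ-≤ (k + 3) m≤16k)
        (trans (cong (_+ suc m) (↭-length same)) (trans (sym (+-identityʳ _)) (cover-length cover)))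
        (record { closed = closed ; unique = unique-resp-↭ (↭-sym same) (cover-unique cover)
                ; bounded = All-resp-↭ (↭-sym same) (cover-upper cover) })
        (λ x<n x∉ → cover-missing cover z≤n x<n (x∉ ∘ ∈-resp-↭ (↭-sym same)))
      where
      open ≤-Reasoning
      m≤16k : m ≤ 16 * k
      m≤16k = begin
        m              ≤⟨ n≤1+n m ⟩
        suc m          ≤⟨ dropped≤ ⟩
        4 * (4 * s)    ≡⟨ *-assoc 4 4 s ⟨
        16 * s         ≤⟨ *-monoʳ-≤ 16 s≤k ⟩
        16 * k         ∎

-- Numerical parameters and the passage to graphs

module _ {n : ℕ} (G : Graph n) where
  open Graph G

  independent-length : ∀ {vs} → Unique vs → IsIndependent _~_ vs → length vs ≤ α G
  independent-length {vs} vs! ind = ≤-trans (length≤∣toSubset∣ vs!)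
    (independent⇒∣S∣≤α G (λ u u∈ v v∈ → ind (∈-toSubset⁻ vs u∈) (∈-toSubset⁻ vs v∈)))
    where
    toSubset : List (Fin n) → Subset n
    toSubset = foldr (λ v S → ⁅ v ⁆ ∪ S) ∅
    ∈-toSubset⁻ : ∀ vs {u} → u ∈ˢ toSubset vs → u ∈ vs
    ∈-toSubset⁻ []       u∈ = contradiction u∈ ∉⊥
    ∈-toSubset⁻ (v ∷ vs) u∈ with x∈p∪q⁻ ⁅ v ⁆ (toSubset vs) u∈
    ... | inj₁ u∈v  = here (x∈⁅y⁆⇒x≡y v u∈v)
    ... | inj₂ u∈vs = there (∈-toSubset⁻ vs u∈vs)
    length≤∣toSubset∣ : ∀ {vs} → Unique vs → length vs ≤ ∣ toSubset vs ∣
    length≤∣toSubset∣ {[]}     _          = z≤n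
    length≤∣toSubset∣ {v ∷ vs} (v∉ ∷ vs!) = ≤-<-trans (length≤∣toSubset∣ vs!)
      (p⊂q⇒∣p∣<∣q∣ (q⊆p∪q ⁅ v ⁆ (toSubset vs) , v , x∈p∪q⁺ (inj₁ (x∈⁅x⁆ v)) ,
        λ v∈ → All.lookup v∉ (∈-toSubset⁻ vs v∈) refl))

-- Past the end of the list, nth returns the default value.
nth : A → List A → ℕ → A
nth d []       _       = d
nth d (x ∷ xs) zero    = x
nth d (x ∷ xs) (suc i) = nth d xs i

nth-∈ : ∀ {d : A} {xs i} → i < length xs → nth d xs i ∈ xs
nth-∈ {xs = x ∷ xs} {zero}  _         = here refl
nth-∈ {xs = x ∷ xs} {suc i} (s≤s i<l) = there (nth-∈ i<l)

nth-injective : ∀ {d : A} {xs i j} → Unique xs → i < length xs → j < length xs →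
  nth d xs i ≡ nth d xs j → i ≡ j
nth-injective {xs = x ∷ xs} {zero}  {zero}  _        _         _         _  = refl
nth-injective {xs = x ∷ xs} {zero}  {suc j} (x∉ ∷ _) _         (s≤s j<l) eq =
  contradiction eq (All.lookup x∉ (nth-∈ j<l))
nth-injective {xs = x ∷ xs} {suc i} {zero}  (x∉ ∷ _) (s≤s i<l) _         eq =
  contradiction (sym eq) (All.lookup x∉ (nth-∈ i<l))
nth-injective {xs = x ∷ xs} {suc i} {suc j} (_ ∷ u)  (s≤s i<l) (s≤s j<l) eq =
  cong suc (nth-injective u i<l j<l eq)

nth-linked : ∀ {R : Rel A 0ℓ} {d z} xs → Linked R (xs ∷ʳ z) → ∀ {i} → suc i < length xs →
  R (nth d xs i) (nth d xs (suc i))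
nth-linked (x ∷ y ∷ xs) (r ∷ _)  {zero}  _         = r
nth-linked (x ∷ y ∷ xs) (_ ∷ rs) {suc i} (s≤s i<l) = nth-linked (y ∷ xs) rs i<l
nth-linked (x ∷ [])     _        (s≤s ())

nth-last-linked : ∀ {R : Rel A 0ℓ} {d z} xs → Linked R (xs ∷ʳ z) → ∀ {i} → suc i ≡ length xs →
  R (nth d xs i) z
nth-last-linked (x ∷ [])     (r ∷ _)  {zero}  _  = r
nth-last-linked (x ∷ y ∷ xs) (_ ∷ rs) {suc i} eq = nth-last-linked (y ∷ xs) rs (suc-injective eq)

path⇒linked : ∀ {R : Rel B 0ℓ} (f : A → B) {a b z xs} →
  Path (λ x y → R (f x) (f y)) a b xs → R (f b) (f z) → Linked R (map f xs ∷ʳ f z)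
path⇒linked f stop                  bz = bz ∷ [-]
path⇒linked f (step e stop)         bz = e ∷ bz ∷ [-]
path⇒linked f (step e p@(step _ _)) bz = e ∷ path⇒linked f p bz

*-^3 : ∀ x y → (x * y) ^ 3 ≡ x ^ 3 * y ^ 3
*-^3 = expanded
  where
  expanded : ∀ x y → x * y * (x * y * (x * y * 1)) ≡ x * (x * (x * 1)) * (y * (y * (y * 1)))
  expanded = solve-∀

-- Keep `s` while its cube is large enough, otherwise pass to `suc s`, whose cube is at most that of
-- `2 * s`; this doubling is the source of the factor 8.
cube-root : ∀ k → ∃[ s ] (1 ≤ s × s ≤ suc k × suc k ≤ s ^ 3 × s ^ 3 ≤ 8 * suc k)
cube-root zero = 1 , ≤-refl , ≤-refl , ≤-refl , s≤s z≤n
cube-root (suc k) with cube-root k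
... | s , 1≤s , s≤k , k≤s³ , s³≤8k with suc (suc k) ≤? s ^ 3
...   | yes k<s³ = s , 1≤s , m≤n⇒m≤1+n s≤k , k<s³ , ≤-trans s³≤8k (*-monoʳ-≤ 8 (n≤1+n (suc k)))
...   | no k≮s³ = suc s , s≤s z≤n , s≤s s≤k ,
    ≤-trans (s≤s k≤s³) (^-monoˡ-< 3 (n<1+n s)) , (begin
      suc s ^ 3          ≤⟨ ^-monoˡ-≤ 3 (+-mono-≤ 1≤s (m≤m+n s 0)) ⟩
      (2 * s) ^ 3        ≡⟨ *-^3 2 s ⟩
      8 * s ^ 3          ≤⟨ *-monoʳ-≤ 8 (≤-trans (s≤s⁻¹ (≰⇒> k≮s³)) (n≤1+n (suc k))) ⟩
      8 * suc (suc k)    ∎)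
  where open ≤-Reasoning

-- The constants are variables here because the type checker would expand
-- a product with a large literal factor in unary.
scale-fit : ∀ c c₀ d {n k s} → c₀ ^ 3 * d ≡ c ^ 3 → s ^ 3 ≤ d * k → n ≥ c · k ^7/3 →
  c₀ * (k * k * s) ≤ n
scale-fit c c₀ d {n} {k} {s} constants s³≤dk big = ≮⇒≥ λ n<c₀kks → <⇒≱ (begin-strict
  n ^ 3                                <⟨ ^-monoˡ-< 3 n<c₀kks ⟩
  (c₀ * (k * k * s)) ^ 3               ≡⟨ *-^3 c₀ (k * k * s) ⟩
  c₀ ^ 3 * (k * k * s) ^ 3             ≡⟨ cong (c₀ ^ 3 *_) (*-^3 (k * k) s) ⟩
  c₀ ^ 3 * ((k * k) ^ 3 * s ^ 3)       ≤⟨ *-monoʳ-≤ (c₀ ^ 3) (*-monoʳ-≤ ((k * k) ^ 3) s³≤dk) ⟩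
  c₀ ^ 3 * ((k * k) ^ 3 * (d * k))     ≡⟨ regroup (c₀ ^ 3) d k ⟩
  c₀ ^ 3 * d * k ^ 7                   ≡⟨ cong (_* k ^ 7) constants ⟩
  c ^ 3 * k ^ 7                        ∎) big
  where
  open ≤-Reasoning
  regroup : ∀ c d k → c * (k * k * (k * k * (k * k * 1)) * (d * k)) ≡
    (c * d) * (k * (k * (k * (k * (k * (k * (k * 1)))))))
  regroup = solve-∀

-- `s` is at most 2k^(1/3), and 24 · 4 = 96 doubled is 192; the `refl` checks 96³ · 8 = 192³.
blocks-fit : ∀ {n k s} → s ^ 3 ≤ 8 * k → n ≥ 192 · k ^7/3 → 24 * (k * k) * (4 * s) ≤ n
blocks-fit {n} {k} {s} s³≤8k big =
  ≤-trans (≤-reflexive (collect 24 4 k s)) (scale-fit 192 96 8 {n} {k} {s} refl s³≤8k big)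
  where
  collect : ∀ b c k s → b * (k * k) * (c * s) ≡ (b * c) * (k * k * s)
  collect = solve-∀

-- From as ≤ k ≤ s³ follows a³k ≤ (as)³ ≤ k³, so a³, a² and a are each at most k². Together with
-- 17k² + 3k this makes at most 23k², whence the 24.
enough-blocks : ∀ {k s a} → 1 ≤ k → 1 ≤ a → k ≤ s ^ 3 → a * s ≤ k →
  a * (a * suc a + 1) + k * (k + 3 + 16 * k) < 24 * (k * k)
enough-blocks {k@(suc _)} {s} {a@(suc _)} _ _ k≤s³ as≤k = begin-strict
  a * (a * suc a + 1) + k * (k + 3 + 16 * k)     ≡⟨ expand a k ⟩
  (a * a * a + a * a + a) + (17 * (k * k) + 3 * k)
    ≤⟨ +-mono-≤ (+-mono-≤ (+-mono-≤ a³≤k² (≤-trans (m≤m*n (a * a) a) a³≤k²))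
                          (≤-trans (m≤n*m a (a * a)) a³≤k²))
                (+-monoʳ-≤ (17 * (k * k)) (*-monoʳ-≤ 3 (m≤m*n k k))) ⟩
  (k * k + k * k + k * k) + (17 * (k * k) + 3 * (k * k)) ≡⟨ total (k * k) ⟩
  23 * (k * k)                                   <⟨ *-monoˡ-< (k * k) (n<1+n 23) ⟩
  24 * (k * k)                                   ∎
  where
  open ≤-Reasoning
  expand : ∀ a k → a * (a * suc a + 1) + k * (k + 3 + 16 * k) ≡
    (a * a * a + a * a + a) + (17 * (k * k) + 3 * k)
  expand = solve-∀
  total : ∀ q → (q + q + q) + (17 * q + 3 * q) ≡ 23 * q
  total = solve-∀
  cube : ∀ x → x * (x * (x * 1)) ≡ x * x * x
  cube = solve-∀
  a³≤k² : a * a * a ≤ k * k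
  a³≤k² = *-cancelʳ-≤ (a * a * a) (k * k) k (begin
    a * a * a * k       ≤⟨ *-monoʳ-≤ (a * a * a) k≤s³ ⟩
    a * a * a * s ^ 3   ≡⟨ trans (*-^3 a s) (cong (_* s ^ 3) (cube a)) ⟨
    (a * s) ^ 3         ≤⟨ ^-monoˡ-≤ 3 as≤k ⟩
    k ^ 3               ≡⟨ cube k ⟩
    k * k * k           ∎)

choose-parameters : ∀ k → 1 ≤ k → ∃[ s ] ∃[ a ]
  (1 ≤ s × s ≤ k × s ^ 3 ≤ 8 * k × (∀ m → m * s ≤ k → m ≤ suc a) ×
   suc a * (suc a * suc (suc a) + 1) + k * (k + 3 + 16 * k) < 24 * (k * k))
choose-parameters k@(suc k-1) 1≤k with cube-root k-1
... | s@(suc _) , 1≤s , s≤k , k≤s³ , s³≤8k with k / s in k/s≡ | m≥n⇒m/n>0 s≤k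
-- `suc a` is the quotient of `k` by `s`, nonzero because `s ≤ k`.
...   | suc a | _ = s , a , 1≤s , s≤k , s³≤8k ,
  (λ m ms≤k → ≤-trans (≤-reflexive (sym (m*n/n≡m m s)))
     (≤-trans (/-monoˡ-≤ s ms≤k) (≤-reflexive k/s≡))) ,
  enough-blocks {k} {s} {suc a} 1≤k (s≤s z≤n) k≤s³ (subst (λ q → q * s ≤ k) k/s≡ (m/n*n≤m k s))

module _ {k n : ℕ} (G : Graph n) (C : Cycle G) (spanning : ∀ v → v ∈ Cycle.vertices C)
         (α≤k : α G ≤ k) where
  open Graph G
  open Cycle C

  length-vertices : length vertices ≡ n
  length-vertices = ≤-antisym
    (≤-trans (unique-⊆-length distinct (λ {v} _ → ∈-allFin v)) (≤-reflexive (length-tabulate id)))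
    (≤-trans (≤-reflexive (sym (length-tabulate id)))
      (unique-⊆-length (Unique.allFin⁺ n) (λ {v} _ → spanning v)))

  at : ℕ → Fin n
  at = nth start vertices

  at-injective : ∀ {i j} → i < n → j < n → at i ≡ at j → i ≡ j
  at-injective i<n j<n = nth-injective distinct
    (<-≤-trans i<n (≤-reflexive (sym length-vertices)))
    (<-≤-trans j<n (≤-reflexive (sym length-vertices)))

  -- Past `n`, `at` falls back on `start`, so distinct indices may name the same vertex; hence the
  -- restriction to indices `< n` in `bound` and `CycleOn`.
  E : Rel ℕ 0ℓ
  E i j = at i ~ at j

  at-unique : ∀ {xs} → All (_< n) xs → Unique xs → Unique (map at xs)
  at-unique xs<n = unique-map⁺ (λ x∈ y∈ → at-injective (All.lookup xs<n x∈) (All.lookup xs<n y∈))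

  bound : IndependenceBound E (_< n) k
  bound I I! I<n ind = ≤-trans (≤-reflexive (sym (length-map at I)))
    (≤-trans (independent-length G (at-unique I<n I!) map-independent) α≤k)
    where
    map-independent : IsIndependent _~_ (map at I)
    map-independent u∈ v∈ with ∈-map⁻ at u∈ | ∈-map⁻ at v∈
    ... | i , i∈ , refl | j , j∈ , refl = ind i∈ j∈

  module P = Positions n k {E} (λ i j → at i ~? at j) ~-sym ~-irrefl bound
    (λ i<n → nth-linked vertices closed (<-≤-trans i<n (≤-reflexive (sym length-vertices))))
    (λ m≡n → nth-last-linked vertices closed (trans m≡n (sym length-vertices)))
  open Absorption n k {E} (λ i j → at i ~? at j) ~-sym ~-irrefl bound using (CycleOn)

  toCycle : ∀ {ys} → CycleOn ys → 4 ≤ n → suc (length ys) ≡ n → ContainsCycleOfLength G (n ∸ 1)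
  toCycle {[]}     _  (s≤s ()) refl
  toCycle {a ∷ ys} C′ 4≤n eq = record
    { start = at a ; rest = map at ys
    ; distinct = at-unique bounded unique
    ; long = ≤-trans (s≤s⁻¹ (≤-trans 4≤n (≤-reflexive (sym eq))))
        (≤-reflexive (cong suc (sym (length-map at ys))))
    ; closed = cyc closed′ } , trans (cong suc (length-map at ys)) (cong pred eq)
    where
    open CycleOn C′ renaming (closed to closed′)
    cyc : ClosedPath E (a ∷ ys) → Linked _~_ (map at (a ∷ ys) ∷ʳ at a)
    cyc (_ , _ , stop , e)       = path⇒linked {R = _~_} at {a = a} {z = a} stop e
    cyc (_ , _ , step e p , ba) = path⇒linked {R = _~_} at {a = a} {z = a} (step e p) ba

theorem1p2 : Σ[ c ∈ ℕ ] (∀ (k : ℕ) → 1 ≤ k → ∀ (n : ℕ) (G : Graph n) → Hamiltonian G →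
    n ≥ c · k ^7/3 → α G ≤ k → ContainsCycleOfLength G (n ∸ 1))
theorem1p2 = 192 , λ k 1≤k n G (C , spanning) big α≤k →
  let s , a , 1≤s , s≤k , s³≤8k , a-max , large = choose-parameters k 1≤k
      fit = blocks-fit {n} {k} {s} s³≤8k big
      -- At least one block of length `4 * s ≥ 4` fits, so `4 ≤ n`, and `n ∸ 1` vertices are enough
      -- for a cycle.
      1≤24k² = *-mono-≤ {1} {24} (s≤s z≤n) (*-mono-≤ 1≤k 1≤k)
      4≤n = ≤-trans (*-mono-≤ 1≤24k² (*-monoʳ-≤ 4 1≤s)) fit
      ys , C′ , len = P.Blocks.almost-spanning-cycle G C spanning α≤k
                        {s} {24 * (k * k)} {a} s≤k a-max fit large
  in toCycle G C spanning α≤k C′ 4≤n len
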